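{- The functions sending $(1^n\,0\,1^k)$ to the Stirling number of the first type $c(n,k)$ and to the Stirling number of the second type $S(n,k)$, respectively, are both in $\#\mathsf{L}$.
   Context: $c(n,k)$ is the (unsigned) Stirling number of the first type: the number of permutations of $n$ elements with exactly $k$ cycles; it satisfies $c(n+1,k)=n\,c(n,k)+c(n,k-1)$. $S(n,k)$ is the Stirling number of the second type: the number of set partitions of an $n$-element set into $k$ nonempty blocks; it satisfies $S(n+1,k)=k\,S(n,k)+S(n,k-1)$. The alphabet is $\Sigma=\{0,1\}$; $1^a$ is the string of $a$ ones and juxtaposition is concatenation. A function given only on strings of a displayed form is extended by $0$ to all other strings. $\#\mathsf{L}$ is the class of functions $f:\Sigma^*\to\mathbb{N}_0$ such that $f(x)$ is the number of accepting computation paths on input $x$ of a fixed nondeterministic Turing machine with read-only input tape that uses $O(\log|x|)$ work space and halts on every computation path. Equivalently: there are a polynomial $q$ and a deterministic $O(\log|x|)$-space Turing machine $M$ with an additional read-once, left-to-right witness tape such that $f(x)=\#\{w\in\Sigma^{q(|x|)}\mid M(x,w)=\mathsf{yes}\}$. -}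

module Defs where

open import Data.Bool using (Bool; true; false; T; if_then_else_)
import Data.Bool.Properties as Bool
open import Data.Bool.ListAction using (and)
open import Data.Fin using (Fin)
import Data.Fin.Properties as Fin
open import Data.Fin.Subset using (Subset; inside; outside; ⁅_⁆; ⋃; ⊤; _∩_; Nonempty; Empty)
open import Data.Fin.Subset.Properties using (nonempty?)
open import Data.List
  using (List; []; _∷_; [_]; _++_; map; length; null; filter; deduplicate; iterate; allFin;
         replicate; cartesianProductWith)
open import Data.List.Membership.Propositional using (_∈_)
open import Data.List.Properties using (length-replicate)
open import Data.List.Relation.Unary.All using (All; all?)
open import Data.List.Relation.Unary.AllPairs using (AllPairs; allPairs?)
import Data.List.Relation.Unary.Unique.Propositional as List
open import Data.Nat using (ℕ; zero; suc; _+_; _*_; _≤_)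
import Data.Nat as ℕ
open import Data.Nat.Logarithm using (⌊log₂_⌋)
open import Data.Product using (∃-syntax; _×_; _,_)
open import Data.Vec using (Vec; []; _∷_; lookup)
import Data.Vec.Properties as Vec
import Data.Vec.Relation.Unary.AllPairs as VecAllPairs
open import Function using (_∘_; flip)
open import Function.Bundles using (_↔_)
open import Induction.WellFounded using (Acc)
open import Relation.Binary.Construct.Closure.ReflexiveTransitive using (Star)
open import Relation.Binary.Definitions using (DecidableEquality)
open import Relation.Binary.PropositionalEquality using (_≡_; _≢_; refl; cong)
open import Relation.Nullary using (contradiction)
open import Relation.Nullary.Decidable using (Dec; ¬?; _×-dec_)

_≟ₛ_ : ∀ {n} → DecidableEquality (Subset n)
_≟ₛ_ = Vec.≡-dec Bool._≟_

vectors : {A : Set} → List A → (m : ℕ) → List (Vec A m)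
vectors as zero    = [ [] ]
vectors as (suc m) = cartesianProductWith _∷_ as (vectors as m)

-- Permutations of Fin n in one-line notation: σ is the map i ↦ lookup σ i.
permutations : (n : ℕ) → List (Vec (Fin n) n)
permutations n =
  filter (VecAllPairs.allPairs? λ i j → ¬? (i Fin.≟ j)) (vectors (allFin n) n)

-- The cycle through i, as a set: { i, σ i, …, σⁿ⁻¹ i }.
cycle : ∀ {n} → Vec (Fin n) n → Fin n → Subset n
cycle {n} σ i = ⋃ (map ⁅_⁆ (iterate (lookup σ) i n))

-- Fixed points count as cycles.
cycles : ∀ {n} → Vec (Fin n) n → List (Subset n)
cycles {n} σ = deduplicate _≟ₛ_ (map (cycle σ) (allFin n))

stirling₁ : ℕ → ℕ → ℕ
stirling₁ n k = length (filter (λ σ → length (cycles σ) ℕ.≟ k) (permutations n))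

-- Sublists of length k.  For a duplicate-free list these represent the
-- k-element sets of its members, each exactly once.
choose : {A : Set} → ℕ → List A → List (List A)
choose zero    xs       = [ [] ]
choose (suc k) []       = []
choose (suc k) (x ∷ xs) = map (x ∷_) (choose k xs) ++ choose (suc k) xs

subsets : (n : ℕ) → List (Subset n)
subsets zero    = [ [] ]
subsets (suc n) = map (outside ∷_) (subsets n) ++ map (inside ∷_) (subsets n)

Disjoint : ∀ {n} → Subset n → Subset n → Set
Disjoint p q = Empty (p ∩ q)

IsSetPartition : ∀ {n} → List (Subset n) → Set
IsSetPartition bs = All Nonempty bs × AllPairs Disjoint bs × ⋃ bs ≡ ⊤

isSetPartition? : ∀ {n} (bs : List (Subset n)) → Dec (IsSetPartition bs)
isSetPartition? bs =
  all? nonempty? bs ×-dec allPairs? (λ p q → ¬? (nonempty? (p ∩ q))) bs ×-dec ⋃ bs ≟ₛ ⊤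

stirling₂ : ℕ → ℕ → ℕ
stirling₂ n k = length (filter isSetPartition? (choose k (subsets n)))

-- false is the letter 0 and true the letter 1.
1ⁿ01ᵏ : ℕ → ℕ → List Bool
1ⁿ01ᵏ n k = replicate n true ++ false ∷ replicate k true

-- The function 1ⁿ01ᵏ ↦ g n k, extended by 0 to all other strings; see
-- extendByZero-on and extendByZero-off.
extendByZero : (ℕ → ℕ → ℕ) → List Bool → ℕ
extendByZero g []          = 0
extendByZero g (true  ∷ x) = extendByZero (g ∘ suc) x
extendByZero g (false ∷ x) = if and x then g 0 (length x) else 0

and-replicate : ∀ k → and (replicate k true) ≡ true
and-replicate zero    = refl
and-replicate (suc k) = and-replicate k

and⇒replicate : ∀ x → and x ≡ true → x ≡ replicate (length x) true
and⇒replicate []         _ = refl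
and⇒replicate (true ∷ x) p = cong (true ∷_) (and⇒replicate x p)

extendByZero-on : ∀ g n k → extendByZero g (1ⁿ01ᵏ n k) ≡ g n k
extendByZero-on g zero k
  rewrite and-replicate k | length-replicate k {true} = refl
extendByZero-on g (suc n) k = extendByZero-on (g ∘ suc) n k

extendByZero-off : ∀ g x → (∀ n k → x ≢ 1ⁿ01ᵏ n k) → extendByZero g x ≡ 0
extendByZero-off g []          _ = refl
extendByZero-off g (true  ∷ x) h =
  extendByZero-off (g ∘ suc) x λ n k e → h (suc n) k (cong (true ∷_) e)
extendByZero-off g (false ∷ x) h with and x in p
... | true  = contradiction (cong (false ∷_) (and⇒replicate x p)) (h 0 (length x))
... | false = refl

data Move : Set where
  left stay right : Move

-- Cells to the left of the head are listed from the head outwards.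
record Tape (A : Set) : Set where
  constructor tape
  field
    lefts  : List A
    head   : A
    rights : List A

write : {A : Set} → A → Tape A → Tape A
write a (tape ls _ rs) = tape ls a rs

-- Moves on a finite tape: at an end of the tape the head stays where it is.
moveBounded : {A : Set} → Move → Tape A → Tape A
moveBounded left  (tape (l ∷ ls) h rs) = tape ls l (h ∷ rs)
moveBounded right (tape ls h (r ∷ rs)) = tape (h ∷ ls) r rs
moveBounded _     t                    = t

-- Moves on a two-way infinite tape all of whose unlisted cells are blank.
moveUnbounded : {A : Set} → A → Move → Tape A → Tape A
moveUnbounded blank left  (tape []       h rs) = tape [] blank (h ∷ rs)
moveUnbounded blank left  (tape (l ∷ ls) h rs) = tape ls l (h ∷ rs)
moveUnbounded blank stay  t                    = t
moveUnbounded blank right (tape ls h [])       = tape (h ∷ ls) blank []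
moveUnbounded blank right (tape ls h (r ∷ rs)) = tape (h ∷ ls) r rs

-- The input is enclosed between two endmarkers.
data InputSymbol : Set where
  ⊢ ⊣ : InputSymbol
  bit  : Bool → InputSymbol

inputTape : List Bool → Tape InputSymbol
inputTape x = tape [] ⊢ (map bit x ++ [ ⊣ ])

IsFinite : Set → Set
IsFinite A = ∃[ n ] (A ↔ Fin n)

record Action (State Symbol : Set) : Set where
  constructor action
  field
    nextState : State
    written   : Symbol
    inputMove : Move
    workMove  : Move

record NTM : Set₁ where
  field
    State         : Set
    state-finite  : IsFinite State
    Symbol        : Set
    symbol-finite : IsFinite Symbol
    blank         : Symbol
    start         : State
    accepting     : State → Bool
    -- The finite set of possible actions in a given state, with given symbols
    -- under the input head and the work head.
    δ             : State → InputSymbol → Symbol → List (Action State Symbol)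
    δ-unique      : ∀ q a b → List.Unique (δ q a b)

module Semantics (M : NTM) where
  open NTM M

  record Config : Set where
    constructor config
    field
      state : State
      input : Tape InputSymbol
      work  : Tape Symbol
  open Config

  initial : List Bool → Config
  initial x = config start (inputTape x) (tape [] blank [])

  actions : Config → List (Action State Symbol)
  actions c = δ (state c) (Tape.head (input c)) (Tape.head (work c))

  apply : Action State Symbol → Config → Config
  apply (action q b i w) c =
    config q (moveBounded i (input c)) (moveUnbounded blank w (write b (work c)))

  infix 4 _⟶_
  _⟶_ : Config → Config → Set
  c ⟶ d = ∃[ t ] (t ∈ actions c × d ≡ apply t c)

  -- Computation paths from c that end in a halting configuration whose state
  -- is accepting.
  data AcceptingPath (c : Config) : Set where
    accept : T (null (actions c)) → T (accepting (state c)) → AcceptingPath c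
    step   : ∀ {t} → t ∈ actions c → AcceptingPath (apply t c) → AcceptingPath c

  -- Every computation path from c is finite.
  Halts : Config → Set
  Halts = Acc (flip _⟶_)

  -- The number of work cells visited so far: a cell is listed once it has been
  -- visited, and is never removed.
  space : Config → ℕ
  space c = length (Tape.lefts (work c)) + suc (length (Tape.rights (work c)))

  UsesLogSpace : Set
  UsesLogSpace =
    ∃[ C ] ∃[ N ] ∀ x → N ≤ length x →
      ∀ c → Star _⟶_ (initial x) c → space c ≤ C * ⌊log₂ length x ⌋

infix 4 _∈#L
_∈#L : (List Bool → ℕ) → Set₁
f ∈#L = ∃[ M ] (let open Semantics M in
  UsesLogSpace ×
  (∀ x → Halts (initial x)) ×
  (∀ x → AcceptingPath (initial x) ↔ Fin (f x)))

{-# OPTIONS --safe #-}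
module Submission where

-- Both functions are counted by nondeterministic machines of the same shape, which build an object
-- one element at a time.
--
-- A set partition of n elements into k blocks, or a permutation of n elements with k cycles, arises by
-- inserting the elements one after the other.  A new element either opens a new block (or cycle),
-- which is possible in one way, or joins an old one: with b blocks so far this is possible in b ways
-- for partitions, and with m elements so far in m ways for permutations, since the new element may be
-- put directly after any old element in its cycle.  The machine keeps two counters: A is the number of
-- ways to join (b or m respectively) and B is the number of blocks or cycles.  While the input head
-- reads 1ⁿ, each 1 makes the machine either open (A and B grow by one) or guess some i < A and join
-- (A grows by κ, where κ is 1 for permutations and 0 for partitions).  After the 0, each of the k ones
-- lowers B by one, and the machine accepts when B is 0 exactly at the right endmarker.  The input head
-- itself counts the elements, so only A and B have to be stored.  Both are at most n and are stored in
-- binary on two tracks of the work tape, whence the logarithmic space bound.  A number i < A is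
-- guessed bit by bit, from the least significant one, while a single bit of state records whether the
-- part of i guessed so far is less than the corresponding part of A; hence exactly A guesses survive.
--
-- The number of accepting paths is thus the function paths below, which unfolds the first insertion.
-- By paths₁-last-suc and paths₂-last-suc it can also be unfolded at the last insertion, and that is
-- the recurrence of the Stirling numbers.
--
-- The recurrences themselves are proved from the definitions as counts.  For stirling₁, a permutation
-- of n + 1 elements is a permutation of n elements together with a transposition of 0 with one of
-- the n + 1 elements (permutations-suc), and the transposition decides whether 0 is a fixed point or
-- joins an old cycle.  For stirling₂, a partition of n + 1 elements is determined by the blocks
-- without 0 and by the rest c of the block of 0.  Either c is empty, and the other blocks are a
-- partition of the n old elements, or c is one more block of such a partition, and the pairs of
-- a partition and one of its blocks are counted in two ways (∑-choose-picks).
--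
-- The three properties demanded of the machine follow from one inductive predicate, Counts, which
-- says of a configuration that its computation tree is finite, stays within given space and has
-- a given number of accepting leaves.
open import Data.Bool using (Bool; true; false; T; if_then_else_; _∧_; _xor_; not)
open import Data.Bool.ListAction using (and)
open import Data.Fin using (Fin; zero; suc; toℕ; punchOut)
import Data.Fin.Properties as Fin
open import Data.Fin.Subset using (Subset; ⋃; ⁅_⁆; _∪_; Nonempty; inside; outside)
import Data.Fin.Subset as Sub
import Data.Fin.Subset.Properties as Sub
open import Data.List
  using (List; []; _∷_; [_]; _++_; _ʳ++_; map; length; null; filter; deduplicate; iterate; allFin;
         tabulate; cartesianProductWith)
open import Data.List.Membership.DecPropositional using (_∈?_)
open import Data.List.Membership.Propositional using (_∈_; _∉_)
open import Data.List.Membership.Propositional.Properties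
  using (∈-++⁻; ∈-map⁺; ∈-map⁻; ∈-filter⁺; ∈-filter⁻; ∈-allFin; ∈-tabulate⁺; ∈-tabulate⁻;
         ∈-deduplicate⁺; ∈-deduplicate⁻; ∈-cartesianProductWith⁺; ∈-cartesianProductWith⁻)
open import Data.List.Membership.Propositional.Properties.WithK using (unique∧set⇒bag)
import Data.List.Properties as List
open import Data.List.Relation.Binary.BagAndSetEquality using (∼bag⇒↭)
open import Data.List.Relation.Binary.Permutation.Propositional
  using (_↭_; ↭-refl; ↭-sym; ↭-trans; ↭⇒↭ₛ; prep; swap)
open import Data.List.Relation.Binary.Permutation.Propositional.Properties
  using (map⁺; ++-comm; ∷↭∷ʳ; All-resp-↭; ∈-resp-↭)
open import Data.List.Relation.Binary.Permutation.Setoid.Properties using (AllPairs-resp-↭)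
open import Data.List.Relation.Unary.All as All using (All; []; _∷_)
import Data.List.Relation.Unary.All.Properties as All
open import Data.List.Relation.Unary.AllPairs as AllPairs using (AllPairs; []; _∷_)
import Data.List.Relation.Unary.AllPairs.Properties as AllPairs
open import Data.List.Relation.Unary.Any using (here; there)
import Data.List.Relation.Unary.Unique.DecPropositional.Properties as DecUnique
import Data.List.Relation.Unary.Unique.Propositional as List
import Data.List.Relation.Unary.Unique.Propositional.Properties as Unique
open import Data.Maybe using (Maybe; just; nothing)
open import Data.Nat using (ℕ; zero; suc; _+_; _*_; _∸_; _^_; _≤_; _<_; _≡ᵇ_; z≤n; s≤s)
import Data.Nat as ℕ
open import Data.Nat.ListAction using (sum)
open import Data.Nat.ListAction.Properties using (sum-++; sum-↭)
open import Data.Nat.Logarithm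
  using (⌊log₂_⌋; ⌊log₂⌋-mono-≤; ⌊log₂[2*b]⌋≡1+⌊log₂b⌋; ⌊log₂[2^n]⌋≡n)
import Data.Nat.Properties as ℕ
open import Data.Nat.Tactic.RingSolver using (solve-∀)
open import Data.Product using (∃-syntax; _×_; _,_; proj₁; proj₂)
open import Data.Product.Function.NonDependent.Propositional using (_×-↔_)
open import Data.Sum using (_⊎_; inj₁; inj₂)
open import Data.Sum.Function.Propositional using (_⊎-↔_)
open import Data.Unit using (⊤; tt)
open import Data.Vec using (Vec; []; _∷_; here; there; lookup)
import Data.Vec as Vec
import Data.Vec.Properties as Vec
import Data.Vec.Relation.Unary.AllPairs as VecAllPairs
import Data.Vec.Relation.Unary.Unique.Propositional.Properties as VecUnique
open import Function using (_∘_; id; mk⇔)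
open import Function.Bundles using (_↔_; mk↔ₛ′)
open import Function.Properties.Inverse using (↔-sym; ↔-trans)
open import Induction.WellFounded using (acc)
open import Relation.Binary.Construct.Closure.ReflexiveTransitive
  using (Star; ε; _◅_; _◅◅_; kleisliStar)
open import Relation.Binary.Definitions using (DecidableEquality)
open import Relation.Binary.PropositionalEquality
  using (_≡_; _≢_; refl; sym; trans; cong; cong₂; subst; subst₂; resp₂; setoid; module ≡-Reasoning)
open import Relation.Nullary using (Dec; yes; no; does; ¬_; contradiction)
open import Relation.Nullary.Decidable using (¬?; does-⇔; dec-true; dec-false)
open import Relation.Unary using (Decidable)

open import Defs

-- Indicators and sums over lists

⟦_⟧ : Bool → ℕ
⟦ false ⟧ = 0
⟦ true  ⟧ = 1

-- The indicator of m ≡ n.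
[_≟_] : ℕ → ℕ → ℕ
[ m ≟ n ] = ⟦ m ≡ᵇ n ⟧

∑ : {A : Set} → List A → (A → ℕ) → ℕ
∑ xs f = sum (map f xs)

∑-++ : {A : Set} (xs ys : List A) (f : A → ℕ) → ∑ (xs ++ ys) f ≡ ∑ xs f + ∑ ys f
∑-++ xs ys f = trans (cong sum (List.map-++ f xs ys)) (sum-++ (map f xs) (map f ys))

∑-map : {A B : Set} (g : A → B) (xs : List A) (f : B → ℕ) → ∑ (map g xs) f ≡ ∑ xs (f ∘ g)
∑-map g xs f = cong sum (sym (List.map-∘ xs))

∑-cong : {A : Set} (xs : List A) {f g : A → ℕ} → (∀ {x} → x ∈ xs → f x ≡ g x) → ∑ xs f ≡ ∑ xs g
∑-cong []       h = refl
∑-cong (x ∷ xs) h = cong₂ _+_ (h (here refl)) (∑-cong xs (h ∘ there))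

∑-zero : {A : Set} (xs : List A) {f : A → ℕ} → (∀ {x} → x ∈ xs → f x ≡ 0) → ∑ xs f ≡ 0
∑-zero []       h = refl
∑-zero (x ∷ xs) h = cong₂ _+_ (h (here refl)) (∑-zero xs (h ∘ there))

∑-+ : {A : Set} (xs : List A) (f g : A → ℕ) → ∑ xs (λ x → f x + g x) ≡ ∑ xs f + ∑ xs g
∑-+ []       f g = refl
∑-+ (x ∷ xs) f g = trans (cong (f x + g x +_) (∑-+ xs f g)) (interchange (f x) (g x) (∑ xs f) (∑ xs g))
  where
  open import Algebra.Properties.CommutativeSemigroup ℕ.+-commutativeSemigroup using (interchange)

∑-* : {A : Set} (c : ℕ) (xs : List A) (f : A → ℕ) → ∑ xs (λ x → c * f x) ≡ c * ∑ xs f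
∑-* c []       f = sym (ℕ.*-zeroʳ c)
∑-* c (x ∷ xs) f = trans (cong (c * f x +_) (∑-* c xs f)) (sym (ℕ.*-distribˡ-+ c (f x) (∑ xs f)))

∑-const : {A : Set} (c : ℕ) (xs : List A) → ∑ xs (λ _ → c) ≡ length xs * c
∑-const c []       = refl
∑-const c (x ∷ xs) = cong (c +_) (∑-const c xs)

∑-cartesianProductWith : {A B C : Set} (g : A → B → C) (xs : List A) (ys : List B) (f : C → ℕ) →
  ∑ (cartesianProductWith g xs ys) f ≡ ∑ xs (λ x → ∑ ys (λ y → f (g x y)))
∑-cartesianProductWith g []       ys f = refl
∑-cartesianProductWith g (x ∷ xs) ys f =
  trans (∑-++ (map (g x) ys) (cartesianProductWith g xs ys) f)
    (cong₂ _+_ (∑-map (g x) ys f) (∑-cartesianProductWith g xs ys f))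

count-∑ : {A : Set} {P : A → Set} (P? : ∀ x → Dec (P x)) (xs : List A) →
  length (filter P? xs) ≡ ∑ xs (λ x → ⟦ does (P? x) ⟧)
count-∑ P? [] = refl
count-∑ P? (x ∷ xs) with does (P? x)
... | true  = cong suc (count-∑ P? xs)
... | false = count-∑ P? xs

-- The number of distinct entries of a list

module _ {A : Set} (_≟_ : DecidableEquality A) where

  distinct : List A → ℕ
  distinct xs = length (deduplicate _≟_ xs)

  private
    others : ∀ a → Decidable (λ x → ¬ a ≡ x)
    others a x = ¬? (a ≟ x)

    length-remove : ∀ {a} xs → List.Unique xs → a ∈ xs →
      suc (length (filter (others a) xs)) ≡ length xs
    length-remove {a} (x ∷ xs) (x∉ ∷ _) (here refl) = cong (suc ∘ length)
      (trans (List.filter-reject (others a) {x} {xs} (λ a≢a → a≢a refl)) (List.filter-all (others a) x∉))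
    length-remove {a} (x ∷ xs) (x∉ ∷ xs!) (there a∈) =
      trans (cong (suc ∘ length) (List.filter-accept (others a) λ { refl → All.lookup x∉ a∈ refl }))
        (cong suc (length-remove xs xs! a∈))

  distinct-∈ : ∀ {a xs} → a ∈ xs → distinct (a ∷ xs) ≡ distinct xs
  distinct-∈ {a} {xs} a∈ =
    length-remove (deduplicate _≟_ xs) (DecUnique.deduplicate-! _≟_ xs) (∈-deduplicate⁺ _≟_ a∈)

  distinct-∉ : ∀ {a xs} → a ∉ xs → distinct (a ∷ xs) ≡ suc (distinct xs)
  distinct-∉ {a} {xs} a∉ = cong (suc ∘ length) (List.filter-all (others a)
    (All.tabulate λ x∈ a≡x → a∉ (subst (_∈ xs) (sym a≡x) (∈-deduplicate⁻ _≟_ xs x∈))))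

∈-map-transfer : {A B C : Set} {f : C → A} {g : C → B} {x : C} {xs : List C} →
  (∀ x y → f x ≡ f y → g x ≡ g y) → f x ∈ map f xs → g x ∈ map g xs
∈-map-transfer {f = f} {g} h i with y , y∈ , e ← ∈-map⁻ f i = subst (_∈ map g _) (sym (h _ y e)) (∈-map⁺ g y∈)

-- The number of distinct values of a map depends only on which arguments it identifies.
distinct-kernel : {A B C : Set} (_≟₁_ : DecidableEquality A) (_≟₂_ : DecidableEquality B)
  (f : C → A) (g : C → B) → (∀ x y → f x ≡ f y → g x ≡ g y) → (∀ x y → g x ≡ g y → f x ≡ f y) →
  ∀ xs → distinct _≟₁_ (map f xs) ≡ distinct _≟₂_ (map g xs)
distinct-kernel _≟₁_ _≟₂_ f g to from [] = refl
distinct-kernel _≟₁_ _≟₂_ f g to from (x ∷ xs)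
  with _∈?_ _≟₁_ (f x) (map f xs)
... | yes fx∈ = trans (distinct-∈ _≟₁_ fx∈)
  (trans (distinct-kernel _≟₁_ _≟₂_ f g to from xs) (sym (distinct-∈ _≟₂_ (∈-map-transfer to fx∈))))
... | no fx∉ = trans (distinct-∉ _≟₁_ fx∉)
  (trans (cong suc (distinct-kernel _≟₁_ _≟₂_ f g to from xs)) (sym (distinct-∉ _≟₂_ (fx∉ ∘ ∈-map-transfer from))))

-- Orbits of an injective map and the cycles of a permutation

Injective : {A B : Set} → (A → B) → Set
Injective f = ∀ {x y} → f x ≡ f y → x ≡ y

module _ {A : Set} (f : A → A) where

  -- The t-th iterate of f.  Its clauses follow those of iterate on lists.
  pow : ℕ → A → A
  pow zero    x = x
  pow (suc t) x = pow t (f x)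

  pow-+ : ∀ s t x → pow (s + t) x ≡ pow t (pow s x)
  pow-+ zero    t x = refl
  pow-+ (suc s) t x = pow-+ s t (f x)

  pow-suc : ∀ t x → pow (suc t) x ≡ f (pow t x)
  pow-suc zero    x = refl
  pow-suc (suc t) x = pow-suc t (f x)

  pow-injective : Injective f → ∀ t → Injective (pow t)
  pow-injective inj zero    e = e
  pow-injective inj (suc t) e = inj (pow-injective inj t e)

  -- y is reachable from x when it is fᵗ x for some t.
  Reach : A → A → Set
  Reach = Star (λ x y → f x ≡ y)

  reach-pow : ∀ t x → Reach x (pow t x)
  reach-pow zero    x = ε
  reach-pow (suc t) x = refl ◅ reach-pow t (f x)

  ∈-iterate⁺ : ∀ {m t} → t < m → ∀ x → pow t x ∈ iterate f x m
  ∈-iterate⁺ {suc m} {zero}  _       x = here refl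
  ∈-iterate⁺ {suc m} {suc t} (s≤s h) x = there (∈-iterate⁺ h (f x))

  ∈-iterate⁻ : ∀ m x {y} → y ∈ iterate f x m → ∃[ t ] (t < m × y ≡ pow t x)
  ∈-iterate⁻ (suc m) x (here e)  = 0 , s≤s z≤n , e
  ∈-iterate⁻ (suc m) x (there i) with t , h , e ← ∈-iterate⁻ m (f x) i = suc t , s≤s h , e

module _ {n : ℕ} {f : Fin n → Fin n} (f-injective : Injective f) where

  -- Every point returns after 1 to n steps: by the pigeonhole principle two of i, f i, …, fⁿ i agree,
  -- and f can be cancelled.
  period : ∀ i → ∃[ d ] (d < n × pow f (suc d) i ≡ i)
  period i with j , k , j<k , e ← Fin.pigeonhole (ℕ.n<1+n n) (λ k → pow f (toℕ k) i)
    with d , j+d≡k ← ℕ.m≤n⇒∃[o]m+o≡n j<k =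
      d
    , ℕ.≤-trans (s≤s (ℕ.m≤n+m d (toℕ j))) (subst (_≤ n) (sym j+d≡k) (Fin.toℕ≤pred[n] k))
    , sym (pow-injective f f-injective (toℕ j) (trans e (trans
        (cong (λ t → pow f t i) (trans (sym j+d≡k) (cong suc (ℕ.+-comm (toℕ j) d))))
        (pow-+ f (suc d) (toℕ j) i))))

  reach-sym : ∀ {i j} → Reach f i j → Reach f j i
  reach-sym ε = ε
  reach-sym {i} (refl ◅ r) with d , _ , e ← period i =
    reach-sym r ◅◅ subst (Reach f (f i)) e (reach-pow f d (f i))

  -- The first n iterates of i exhaust its orbit: the step that leaves the list leads back into it,
  -- because the period is at most n.
  iterate-closed : ∀ i {j k} → Reach f j k → j ∈ iterate f i n → k ∈ iterate f i n
  iterate-closed i ε h = h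
  iterate-closed i {j} (refl ◅ r) h = iterate-closed i r next
    where
    next : f j ∈ iterate f i n
    next with t , t<n , refl ← ∈-iterate⁻ f n i h with ℕ.m≤n⇒m<n∨m≡n t<n
    ... | inj₁ t+1<n = subst (_∈ _) (pow-suc f t i) (∈-iterate⁺ f t+1<n i)
    ... | inj₂ refl  with d , d<n , e ← period i =
      subst (_∈ _) wrap (∈-iterate⁺ f {t = t ∸ d} (s≤s (ℕ.m∸n≤m t d)) i)
      where
      wrap : pow f (t ∸ d) i ≡ f (pow f t i)
      wrap = trans (cong (pow f (t ∸ d)) (sym e)) (trans (sym (pow-+ f (suc d) (t ∸ d) i))
        (trans (cong (λ s → pow f (suc s) i) (ℕ.m+[n∸m]≡n (ℕ.≤-pred d<n))) (pow-suc f t i)))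

  reach⇒∈-iterate : ∀ {i j} → Reach f i j → j ∈ iterate f i n
  reach⇒∈-iterate {i} r = iterate-closed i r (∈-iterate⁺ f (ℕ.≤-trans (s≤s z≤n) (Fin.toℕ<n i)) i)

∈-⋃⁺ : ∀ {n} {x : Fin n} {p} {ps} → p ∈ ps → x Sub.∈ p → x Sub.∈ ⋃ ps
∈-⋃⁺ {ps = p ∷ ps} (here refl) x∈ = Sub.x∈p∪q⁺ (inj₁ x∈)
∈-⋃⁺ {ps = p ∷ ps} (there i)   x∈ = Sub.x∈p∪q⁺ {p = p} (inj₂ (∈-⋃⁺ i x∈))

∈-⋃⁻ : ∀ {n} {x : Fin n} ps → x Sub.∈ ⋃ ps → ∃[ p ] (p ∈ ps × x Sub.∈ p)
∈-⋃⁻ []       x∈ = contradiction x∈ Sub.∉⊥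
∈-⋃⁻ (p ∷ ps) x∈ with Sub.x∈p∪q⁻ p (⋃ ps) x∈
... | inj₁ i = p , here refl , i
... | inj₂ i with q , q∈ , x∈q ← ∈-⋃⁻ ps i = q , there q∈ , x∈q

module _ {n : ℕ} (σ : Vec (Fin n) n) (σ-injective : Injective (lookup σ)) where

  -- The cycle through i consists of the points reachable from i.
  ∈-cycle⁺ : ∀ {i j} → Reach (lookup σ) i j → j Sub.∈ cycle σ i
  ∈-cycle⁺ {i} {j} r = ∈-⋃⁺ (∈-map⁺ ⁅_⁆ (reach⇒∈-iterate σ-injective r)) (Sub.x∈⁅x⁆ j)

  ∈-cycle⁻ : ∀ {i j} → j Sub.∈ cycle σ i → Reach (lookup σ) i j
  ∈-cycle⁻ {i} {j} j∈ with _ , p∈ , j∈p ← ∈-⋃⁻ (map ⁅_⁆ (iterate (lookup σ) i n)) j∈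
    with k , k∈ , refl ← ∈-map⁻ ⁅_⁆ p∈
    with refl ← Sub.x∈⁅y⁆⇒x≡y k j∈p
    with t , _ , refl ← ∈-iterate⁻ (lookup σ) n i k∈ = reach-pow (lookup σ) t i

  cycle≡⇒reach : ∀ {i j} → cycle σ i ≡ cycle σ j → Reach (lookup σ) i j
  cycle≡⇒reach {i} {j} e = ∈-cycle⁻ (subst (j Sub.∈_) (sym e) (∈-cycle⁺ ε))

  reach⇒cycle≡ : ∀ {i j} → Reach (lookup σ) i j → cycle σ i ≡ cycle σ j
  reach⇒cycle≡ r = Sub.⊆-antisym (λ x∈ → ∈-cycle⁺ (reach-sym σ-injective r ◅◅ ∈-cycle⁻ x∈))
    (λ x∈ → ∈-cycle⁺ (r ◅◅ ∈-cycle⁻ x∈))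

-- Insertion of an element into a permutation

-- The transposition of zero and o; the identity when o is zero.
swap₀ : ∀ {n} → Fin (suc n) → Fin (suc n) → Fin (suc n)
swap₀ o zero      = o
swap₀ o x@(suc _) = if does (x Fin.≟ o) then zero else x

swap₀-same : ∀ {n} (o : Fin (suc n)) → swap₀ o o ≡ zero
swap₀-same zero = refl
swap₀-same (suc i) with i Fin.≟ i
... | yes _   = refl
... | no  i≢i = contradiction refl i≢i

swap₀-other : ∀ {n} (o : Fin (suc n)) j → suc j ≢ o → swap₀ o (suc j) ≡ suc j
swap₀-other o j j≢o with suc j Fin.≟ o
... | yes e = contradiction e j≢o
... | no  _ = refl

swap₀-involutive : ∀ {n} (o x : Fin (suc n)) → swap₀ o (swap₀ o x) ≡ x
swap₀-involutive o zero    = swap₀-same o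
swap₀-involutive o (suc j) with suc j Fin.≟ o
... | yes e   = sym e
... | no  j≢o = swap₀-other o j j≢o

swap₀-injective : ∀ {n} (o : Fin (suc n)) → Injective (swap₀ o)
swap₀-injective o {x} {y} e = trans (sym (swap₀-involutive o x)) (trans (cong (swap₀ o) e) (swap₀-involutive o y))

module _ {n : ℕ} (σ : Vec (Fin n) n) where

  -- σ on the successors, with zero as an additional fixed point.
  extend : Fin (suc n) → Fin (suc n)
  extend zero    = zero
  extend (suc j) = suc (lookup σ j)

  -- Insertion of zero into σ.  As a map, insert zero has the fixed point zero, and insert (suc i) puts
  -- zero directly after suc i: it sends suc i to zero and zero to suc (σ i).
  insert : Fin (suc n) → Vec (Fin (suc n)) (suc n)
  insert o = Vec.tabulate (extend ∘ swap₀ o)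

  lookup-insert : ∀ o x → lookup (insert o) x ≡ extend (swap₀ o x)
  lookup-insert o = Vec.lookup∘tabulate (extend ∘ swap₀ o)

  extend-injective : Injective (lookup σ) → Injective extend
  extend-injective inj {zero}  {zero}  e = refl
  extend-injective inj {suc i} {suc j} e = cong suc (inj (Fin.suc-injective e))

  -- Insertion preserves being a permutation; injectivity of insertion is insert-unique.
  insert-injective : Injective (lookup σ) → ∀ o → Injective (lookup (insert o))
  insert-injective inj o {x} {y} e = swap₀-injective o (extend-injective inj
    (trans (sym (lookup-insert o x)) (trans e (lookup-insert o y))))

extend-zero : ∀ {n} (σ : Vec (Fin n) n) x → extend σ x ≡ zero → x ≡ zero
extend-zero σ zero e = refl

vec-ext : ∀ {A : Set} {n} {u v : Vec A n} → (∀ i → lookup u i ≡ lookup v i) → u ≡ v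
vec-ext {u = u} {v} h = trans (sym (Vec.tabulate∘lookup u)) (trans (Vec.tabulate-cong h) (Vec.tabulate∘lookup v))

-- The element o can be recovered as the place of zero.
insert-unique : ∀ {n} {σ τ : Vec (Fin n) n} {o p} → insert σ o ≡ insert τ p → σ ≡ τ × o ≡ p
insert-unique {n} {σ} {τ} {o} {p} e with same-place
  where
  values : ∀ x → extend σ (swap₀ o x) ≡ extend τ (swap₀ p x)
  values x = trans (sym (lookup-insert σ o x)) (trans (cong (λ v → lookup v x) e) (lookup-insert τ p x))
  same-place : o ≡ p
  same-place = swap₀-injective p (trans
    (extend-zero τ (swap₀ p o) (trans (sym (values o)) (cong (extend σ) (swap₀-same o))))
    (sym (swap₀-same p)))
... | refl = vec-ext (λ j → Fin.suc-injective (trans (cong (extend σ) (sym (swap₀-involutive o (suc j))))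
    (trans (values (swap₀ o (suc j))) (cong (extend τ) (swap₀-involutive o (suc j)))))) , refl
  where
  values : ∀ x → extend σ (swap₀ o x) ≡ extend τ (swap₀ o x)
  values x = trans (sym (lookup-insert σ o x)) (trans (cong (λ v → lookup v x) e) (lookup-insert τ o x))

injective⇒onto : ∀ {n} {f : Fin (suc n) → Fin (suc n)} → Injective f → ∀ y → ∃[ x ] f x ≡ y
injective⇒onto {n} {f} inj y with Fin.any? (λ x → f x Fin.≟ y)
... | yes h = h
... | no  h = contradiction
  (Fin.injective⇒≤ {f = λ x → punchOut (misses x)}
    (λ {x} {x′} e → inj (Fin.punchOut-injective (misses x) (misses x′) e)))
  ℕ.1+n≰n
  where
  misses : ∀ x → y ≢ f x
  misses x e = h (x , sym e)

-- Composing π with the transposition of zero and the place o of zero gives a permutation that fixes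
-- zero, so that σ is its restriction to the successors.
insert-onto : ∀ {n} (π : Vec (Fin (suc n)) (suc n)) → Injective (lookup π) →
  ∃[ σ ] ∃[ o ] (Injective (lookup σ) × π ≡ insert σ o)
insert-onto {n} π inj with o , o↦0 ← injective⇒onto inj zero = σ , o , σ-injective , vec-ext agree
  where
  fixed : Fin (suc n) → Fin (suc n)
  fixed x = lookup π (swap₀ o x)
  fixed-injective : Injective fixed
  fixed-injective e = swap₀-injective o (inj e)
  nonzero : ∀ j → fixed zero ≢ fixed (suc j)
  nonzero j e with fixed-injective {zero} {suc j} e
  ... | ()
  0≢ : ∀ j → zero ≢ fixed (suc j)
  0≢ j e = nonzero j (trans o↦0 e)
  σ : Vec (Fin n) n
  σ = Vec.tabulate (λ j → punchOut (0≢ j))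
  suc-σ : ∀ j → suc (lookup σ j) ≡ fixed (suc j)
  suc-σ j = trans (cong suc (Vec.lookup∘tabulate _ j)) (Fin.punchIn-punchOut (0≢ j))
  σ-injective : Injective (lookup σ)
  σ-injective {i} {j} e = Fin.suc-injective (fixed-injective (trans (sym (suc-σ i)) (trans (cong suc e) (suc-σ j))))
  extend-σ : ∀ x → extend σ x ≡ fixed x
  extend-σ zero    = sym o↦0
  extend-σ (suc j) = suc-σ j
  agree : ∀ x → lookup π x ≡ lookup (insert σ o) x
  agree x = sym (trans (lookup-insert σ o x) (trans (extend-σ (swap₀ o x)) (cong (lookup π) (swap₀-involutive o x))))

-- The permutations of one more element

vectors-complete : ∀ {A : Set} {as : List A} → (∀ a → a ∈ as) → ∀ {m} (v : Vec A m) → v ∈ vectors as m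
vectors-complete all []      = here refl
vectors-complete all (a ∷ v) = ∈-cartesianProductWith⁺ _∷_ (all a) (vectors-complete all v)

vectors-unique : ∀ {A : Set} {as : List A} → List.Unique as → ∀ m → List.Unique (vectors as m)
vectors-unique as! zero    = [] ∷ []
vectors-unique as! (suc m) = Unique.cartesianProductWith⁺ _∷_ Vec.∷-injective as! (vectors-unique as! m)

distinct-entries? : ∀ {n} → Decidable (VecAllPairs.AllPairs (λ (i j : Fin n) → ¬ i ≡ j) {n})
distinct-entries? = VecAllPairs.allPairs? (λ i j → ¬? (i Fin.≟ j))

∈-permutations⁺ : ∀ {n} {σ : Vec (Fin n) n} → Injective (lookup σ) → σ ∈ permutations n
∈-permutations⁺ {n} {σ} inj = ∈-filter⁺ distinct-entries? (vectors-complete ∈-allFin σ)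
  (subst (VecAllPairs.AllPairs _) (Vec.tabulate∘lookup σ) (VecUnique.tabulate⁺ inj))

∈-permutations⁻ : ∀ {n} {σ : Vec (Fin n) n} → σ ∈ permutations n → Injective (lookup σ)
∈-permutations⁻ {n} {σ} i {x} {y} =
  VecUnique.lookup-injective (proj₂ (∈-filter⁻ distinct-entries? {xs = vectors (allFin n) n} i)) x y

permutations-unique : ∀ n → List.Unique (permutations n)
permutations-unique n = Unique.filter⁺ distinct-entries? (vectors-unique (Unique.allFin⁺ n) n)

-- Both lists are free of duplicates and have the same members.
permutations-suc : ∀ n → permutations (suc n) ↭ cartesianProductWith insert (permutations n) (allFin (suc n))
permutations-suc n = ∼bag⇒↭ (unique∧set⇒bag (permutations-unique (suc n))
  (Unique.cartesianProductWith⁺ insert insert-unique (permutations-unique n) (Unique.allFin⁺ (suc n)))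
  (mk⇔ to from))
  where
  to : ∀ {π} → π ∈ permutations (suc n) → π ∈ cartesianProductWith insert (permutations n) (allFin (suc n))
  to {π} i with σ , o , inj , refl ← insert-onto π (∈-permutations⁻ i) =
    ∈-cartesianProductWith⁺ insert (∈-permutations⁺ inj) (∈-allFin o)
  from : ∀ {π} → π ∈ cartesianProductWith insert (permutations n) (allFin (suc n)) → π ∈ permutations (suc n)
  from i with σ , o , σ∈ , _ , refl ← ∈-cartesianProductWith⁻ insert (permutations n) (allFin (suc n)) i =
    ∈-permutations⁺ (insert-injective σ (∈-permutations⁻ σ∈) o)

-- The cycles after an insertion

module _ {n : ℕ} (σ : Vec (Fin n) n) where

  insert-edge : ∀ o j → suc j ≢ o → lookup (insert σ o) (suc j) ≡ suc (lookup σ j)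
  insert-edge o j j≢o = trans (lookup-insert σ o (suc j)) (cong (extend σ) (swap₀-other o j j≢o))

  insert-into : ∀ o → lookup (insert σ o) o ≡ zero
  insert-into o = trans (lookup-insert σ o o) (cong (extend σ) (swap₀-same o))

  -- A step of σ from i is one step of insert σ o, or two with a stop at zero when o is suc i.
  reach-insert⁺ : ∀ o {i j} → Reach (lookup σ) i j → Reach (lookup (insert σ o)) (suc i) (suc j)
  reach-insert⁺ o = kleisliStar suc edge
    where
    edge : ∀ {i j} → lookup σ i ≡ j → Reach (lookup (insert σ o)) (suc i) (suc j)
    edge {i} refl with suc i Fin.≟ o
    ... | no  i≢o  = insert-edge o i i≢o ◅ ε
    ... | yes refl = insert-into (suc i) ◅ lookup-insert σ (suc i) zero ◅ ε

  -- Identifies zero with d.  When zero has been inserted after suc d, this contracts the detour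
  -- through zero.
  collapse : Fin n → Fin (suc n) → Fin n
  collapse d zero    = d
  collapse d (suc j) = j

  reach-insert⁻ : ∀ o {i j} → Reach (lookup (insert σ o)) (suc i) (suc j) → Reach (lookup σ) i j
  -- Here zero is a loop of its own, so that any value of collapse at zero would do.
  reach-insert⁻ zero {i} {j} = kleisliStar (collapse i) (λ {x} {y} → edge {x} {y}) {suc i} {suc j}
    where
    edge : ∀ {x y} → lookup (insert σ zero) x ≡ y → Reach (lookup σ) (collapse i x) (collapse i y)
    edge {zero}  refl = ε
    edge {suc j} refl rewrite insert-edge zero j (λ ()) = refl ◅ ε
  reach-insert⁻ (suc k) {i} {j} = kleisliStar (collapse k) (λ {x} {y} → edge {x} {y}) {suc i} {suc j}
    where
    edge : ∀ {x y} → lookup (insert σ (suc k)) x ≡ y → Reach (lookup σ) (collapse k x) (collapse k y)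
    edge {zero}  refl = refl ◅ ε
    edge {suc j} refl with suc j Fin.≟ suc k
    ... | yes refl rewrite insert-into (suc k) = ε
    ... | no  j≢k  rewrite insert-edge (suc k) j j≢k = refl ◅ ε

  zero-isolated : ∀ {x y} → Reach (lookup (insert σ zero)) x y → x ≡ zero → y ≡ zero
  zero-isolated ε          e    = e
  zero-isolated (refl ◅ r) refl = zero-isolated r (insert-into zero)

  module _ (σ-injective : Injective (lookup σ)) (o : Fin (suc n)) where
    private
      π = insert σ o
      π-injective : Injective (lookup π)
      π-injective = insert-injective σ σ-injective o

    -- The old elements lie on as many cycles as before, whatever o is.
    cycles-old : distinct _≟ₛ_ (map (cycle π) (tabulate suc)) ≡ length (cycles σ)
    cycles-old = trans
      (cong (distinct _≟ₛ_)
        (trans (List.map-tabulate suc (cycle π)) (sym (List.map-tabulate id (cycle π ∘ suc)))))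
      (distinct-kernel _≟ₛ_ _≟ₛ_ (cycle π ∘ suc) (cycle σ)
        (λ i j e → reach⇒cycle≡ σ σ-injective (reach-insert⁻ o (cycle≡⇒reach π π-injective e)))
        (λ i j e → reach⇒cycle≡ π π-injective (reach-insert⁺ o (cycle≡⇒reach σ σ-injective e)))
        (allFin n))

  cycles-insert-zero : Injective (lookup σ) → length (cycles (insert σ zero)) ≡ suc (length (cycles σ))
  cycles-insert-zero inj = trans (distinct-∉ _≟ₛ_ new) (cong suc (cycles-old inj zero))
    where
    new : cycle (insert σ zero) zero ∉ map (cycle (insert σ zero)) (tabulate suc)
    new i with x , x∈ , e ← ∈-map⁻ (cycle (insert σ zero)) i
      with j , refl ← ∈-tabulate⁻ {f = suc} x∈
      with zero-isolated (cycle≡⇒reach (insert σ zero) (insert-injective σ inj zero) {zero} {suc j} e) refl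
    ... | ()

  cycles-insert-suc : Injective (lookup σ) → ∀ k → length (cycles (insert σ (suc k))) ≡ length (cycles σ)
  cycles-insert-suc inj k = trans (distinct-∈ _≟ₛ_ old) (cycles-old inj (suc k))
    where
    π = insert σ (suc k)
    old : cycle π zero ∈ map (cycle π) (tabulate suc)
    old = subst (_∈ map (cycle π) (tabulate suc))
      (reach⇒cycle≡ π (insert-injective σ inj (suc k)) {suc k} {zero} (insert-into (suc k) ◅ ε))
      (∈-map⁺ (cycle π) (∈-tabulate⁺ {f = suc} k))

-- The recurrence of the Stirling numbers of the first kind

stirling₁-∑ : ∀ n k → stirling₁ n k ≡ ∑ (permutations n) (λ σ → [ length (cycles σ) ≟ k ])
stirling₁-∑ n k = count-∑ (λ σ → length (cycles σ) ℕ.≟ k) (permutations n)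

-- Over each permutation of n elements lie one insertion that adds a cycle and n that do not.
stirling₁-suc : ∀ n k → stirling₁ (suc n) k ≡
  ∑ (permutations n) (λ σ → [ suc (length (cycles σ)) ≟ k ]) + n * stirling₁ n k
stirling₁-suc n k = begin
  stirling₁ (suc n) k
    ≡⟨ stirling₁-∑ (suc n) k ⟩
  ∑ (permutations (suc n)) w
    ≡⟨ sum-↭ (map⁺ w (permutations-suc n)) ⟩
  ∑ (cartesianProductWith insert (permutations n) (allFin (suc n))) w
    ≡⟨ ∑-cartesianProductWith insert (permutations n) (allFin (suc n)) w ⟩
  ∑ (permutations n) (λ σ → ∑ (allFin (suc n)) (λ o → w (insert σ o)))
    ≡⟨ ∑-cong (permutations n) each ⟩
  ∑ (permutations n) (λ σ → [ suc (length (cycles σ)) ≟ k ] + n * [ length (cycles σ) ≟ k ])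
    ≡⟨ ∑-+ (permutations n) _ _ ⟩
  ∑ (permutations n) (λ σ → [ suc (length (cycles σ)) ≟ k ])
    + ∑ (permutations n) (λ σ → n * [ length (cycles σ) ≟ k ])
    ≡⟨ cong (∑ (permutations n) (λ σ → [ suc (length (cycles σ)) ≟ k ]) +_)
         (trans (∑-* n (permutations n) _) (cong (n *_) (sym (stirling₁-∑ n k)))) ⟩
  ∑ (permutations n) (λ σ → [ suc (length (cycles σ)) ≟ k ]) + n * stirling₁ n k ∎
  where
  open ≡-Reasoning
  w : ∀ {n} → Vec (Fin n) n → ℕ
  w σ = [ length (cycles σ) ≟ k ]
  each : ∀ {σ} → σ ∈ permutations n →
    ∑ (allFin (suc n)) (λ o → w (insert σ o)) ≡ [ suc (length (cycles σ)) ≟ k ] + n * [ length (cycles σ) ≟ k ]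
  each {σ} σ∈ = cong₂ _+_
    (cong [_≟ k ] (cycles-insert-zero σ inj))
    (trans (∑-cong (tabulate suc) later) (trans (∑-const (w σ) (tabulate {n = n} suc))
      (cong (_* w σ) (List.length-tabulate {n = n} suc))))
    where
    inj = ∈-permutations⁻ σ∈
    later : ∀ {o} → o ∈ tabulate suc → w (insert σ o) ≡ w σ
    later o∈ with j , refl ← ∈-tabulate⁻ {f = suc} o∈ =
      cong [_≟ k ] (cycles-insert-suc σ inj j)

stirling₁-suc-zero : ∀ n → stirling₁ (suc n) 0 ≡ n * stirling₁ n 0
stirling₁-suc-zero n = trans (stirling₁-suc n 0)
  (cong (_+ n * stirling₁ n 0) (∑-zero (permutations n) (λ _ → refl)))

stirling₁-suc-suc : ∀ n k → stirling₁ (suc n) (suc k) ≡ stirling₁ n k + n * stirling₁ n (suc k)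
stirling₁-suc-suc n k = trans (stirling₁-suc n (suc k))
  (cong (_+ n * stirling₁ n (suc k)) (sym (stirling₁-∑ n k)))

-- Sums over sublists of given length

length-choose : {A : Set} (k : ℕ) (xs : List A) {bs : List A} → bs ∈ choose k xs → length bs ≡ k
length-choose zero    xs       (here refl) = refl
length-choose (suc k) (x ∷ xs) i with ∈-++⁻ (map (x ∷_) (choose k xs)) i
... | inj₁ j with _ , bs∈ , refl ← ∈-map⁻ (x ∷_) j = cong suc (length-choose k xs bs∈)
... | inj₂ j = length-choose (suc k) xs j

∑-choose-suc : {A : Set} (k : ℕ) (x : A) (xs : List A) (f : List A → ℕ) →
  ∑ (choose (suc k) (x ∷ xs)) f ≡ ∑ (choose k xs) (f ∘ (x ∷_)) + ∑ (choose (suc k) xs) f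
∑-choose-suc k x xs f = trans (∑-++ (map (x ∷_) (choose k xs)) (choose (suc k) xs) f)
  (cong (_+ ∑ (choose (suc k) xs) f) (∑-map (x ∷_) (choose k xs) f))

∑-choose-map : {A B : Set} (h : A → B) (k : ℕ) (xs : List A) (f : List B → ℕ) →
  ∑ (choose k (map h xs)) f ≡ ∑ (choose k xs) (f ∘ map h)
∑-choose-map h zero    xs       f = refl
∑-choose-map h (suc k) []       f = refl
∑-choose-map h (suc k) (x ∷ xs) f = trans (∑-choose-suc k (h x) (map h xs) f)
  (trans (cong₂ _+_ (∑-choose-map h k xs (f ∘ (h x ∷_))) (∑-choose-map h (suc k) xs f))
    (sym (∑-choose-suc k x xs (f ∘ map h))))

∑-choose-one : {A : Set} (xs : List A) (f : List A → ℕ) → ∑ (choose 1 xs) f ≡ ∑ xs (λ x → f (x ∷ []))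
∑-choose-one []       f = refl
∑-choose-one (x ∷ xs) f = trans (∑-choose-suc 0 x xs f)
  (cong₂ _+_ (ℕ.+-identityʳ _) (∑-choose-one xs f))

-- If f vanishes on lists that do not have exactly one entry from the second part, then only the
-- sublists with exactly one such entry contribute.
∑-choose-split : {A B C : Set} (g : A → C) (h : B → C) (k : ℕ) (xs : List A) (ys : List B)
  (f : List C → ℕ) → (∀ as bs → length bs ≢ 1 → f (map g as ++ map h bs) ≡ 0) →
  ∑ (choose (suc k) (map g xs ++ map h ys)) f
    ≡ ∑ (choose k xs) (λ as → ∑ ys (λ b → f (map g as ++ h b ∷ [])))
∑-choose-split g h zero [] ys f vanish =
  trans (∑-choose-map h 1 ys f) (trans (∑-choose-one ys (f ∘ map h)) (sym (ℕ.+-identityʳ _)))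
∑-choose-split g h (suc k) [] ys f vanish =
  trans (∑-choose-map h (suc (suc k)) ys f)
    (∑-zero (choose (suc (suc k)) ys) λ {bs} i → vanish [] bs λ e →
      contradiction (trans (sym (length-choose (suc (suc k)) ys i)) e) λ ())
∑-choose-split g h zero (x ∷ xs) ys f vanish =
  trans (∑-choose-suc 0 (g x) (map g xs ++ map h ys) f)
    (cong₂ _+_ (trans (ℕ.+-identityʳ _) (vanish (x ∷ []) [] λ ())) (∑-choose-split g h zero xs ys f vanish))
∑-choose-split g h (suc k) (x ∷ xs) ys f vanish =
  trans (∑-choose-suc (suc k) (g x) (map g xs ++ map h ys) f)
    (trans (cong₂ _+_ (∑-choose-split g h k xs ys (f ∘ (g x ∷_)) (vanish ∘ (x ∷_)))
                      (∑-choose-split g h (suc k) xs ys f vanish))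
      (sym (∑-choose-suc k x xs (λ as → ∑ ys (λ b → f (map g as ++ h b ∷ []))))))

-- All ways of singling out one entry c of a list; r is the list of the others.
picks : {A : Set} → List A → List (A × List A)
picks []       = []
picks (x ∷ xs) = (x , xs) ∷ map (λ (c , r) → c , x ∷ r) (picks xs)

length-picks : {A : Set} (xs : List A) → length (picks xs) ≡ length xs
length-picks []       = refl
length-picks (x ∷ xs) = cong suc (trans (List.length-map _ (picks xs)) (length-picks xs))

picks-↭ : {A : Set} (xs : List A) {c : A} {r : List A} → (c , r) ∈ picks xs → c ∷ r ↭ xs
picks-↭ (x ∷ xs) (here refl) = ↭-refl
picks-↭ (x ∷ xs) (there i) with (c , r) , j , refl ← ∈-map⁻ (λ (c , r) → c , x ∷ r) i =
  ↭-trans (swap c x ↭-refl) (prep x (picks-↭ xs j))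

-- Double counting of a set with a distinguished element: either choose k + 1 elements and single out
-- one, or choose k elements and add another one.  The elements c already in r are excluded by the
-- assumption on g.
∑-choose-picks : {A : Set} (k : ℕ) (xs : List A) (g : A → List A → ℕ) →
  (∀ c r → c ∈ r → g c r ≡ 0) →
  ∑ (choose (suc k) xs) (λ bs → ∑ (picks bs) (λ (c , r) → g c r))
    ≡ ∑ (choose k xs) (λ r → ∑ xs (λ c → g c r))
∑-choose-picks k [] g vanish = sym (∑-zero (choose k []) (λ _ → refl))
∑-choose-picks k (x ∷ xs) g vanish = begin
  ∑ (choose (suc k) (x ∷ xs)) P
    ≡⟨ ∑-choose-suc k x xs P ⟩
  ∑ (choose k xs) (P ∘ (x ∷_)) + ∑ (choose (suc k) xs) P
    ≡⟨ cong₂ _+_ (trans (∑-cong (choose k xs) (λ {bs} _ → cong (g x bs +_) (∑-map _ (picks bs) _)))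
         (∑-+ (choose k xs) (g x) P′)) (∑-choose-picks k xs g vanish) ⟩
  ∑ (choose k xs) (g x) + ∑ (choose k xs) P′ + ∑ (choose k xs) Q
    ≡⟨ regroup k ⟩
  ∑ (choose k (x ∷ xs)) (λ r → g x r + Q r) ∎
  where
  open ≡-Reasoning
  P P′ Q : List _ → ℕ
  P  bs = ∑ (picks bs) (λ (c , r) → g c r)
  P′ bs = ∑ (picks bs) (λ (c , r) → g c (x ∷ r))
  Q  r  = ∑ xs (λ c → g c r)
  regroup : ∀ k → ∑ (choose k xs) (g x) + ∑ (choose k xs) P′ + ∑ (choose k xs) Q
    ≡ ∑ (choose k (x ∷ xs)) (λ r → g x r + Q r)
  regroup zero = arith (g x []) (Q [])
    where
    arith : ∀ a b → a + 0 + 0 + (b + 0) ≡ a + b + 0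
    arith = solve-∀
  regroup (suc k) = begin
    ∑ (choose (suc k) xs) (g x) + ∑ (choose (suc k) xs) P′ + ∑ (choose (suc k) xs) Q
      ≡⟨ cong (λ s → ∑ (choose (suc k) xs) (g x) + s + ∑ (choose (suc k) xs) Q)
           (∑-choose-picks k xs (λ c r → g c (x ∷ r)) (λ c r i → vanish c (x ∷ r) (there i))) ⟩
    ∑ (choose (suc k) xs) (g x) + ∑ (choose k xs) (Q ∘ (x ∷_)) + ∑ (choose (suc k) xs) Q
      ≡⟨ arith (∑ (choose (suc k) xs) (g x)) (∑ (choose k xs) (Q ∘ (x ∷_))) (∑ (choose (suc k) xs) Q) ⟩
    ∑ (choose k xs) (Q ∘ (x ∷_)) + (∑ (choose (suc k) xs) (g x) + ∑ (choose (suc k) xs) Q)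
      ≡⟨ cong₂ _+_
           (∑-cong (choose k xs) (λ {r} _ → cong (_+ Q (x ∷ r)) (sym (vanish x (x ∷ r) (here refl)))))
           (sym (∑-+ (choose (suc k) xs) (g x) Q)) ⟩
    ∑ (choose k xs) (λ r → g x (x ∷ r) + Q (x ∷ r)) + ∑ (choose (suc k) xs) (λ r → g x r + Q r)
      ≡⟨ ∑-choose-suc k x xs (λ r → g x r + Q r) ⟨
    ∑ (choose (suc k) (x ∷ xs)) (λ r → g x r + Q r) ∎
    where
    arith : ∀ a b c → a + b + c ≡ b + (a + c)
    arith = solve-∀

-- Sets of subsets that are partitions

-- The empty set occurs exactly once among the subsets.
∑-subsets-empty : ∀ n (f : Subset n → ℕ) → (∀ c → Nonempty c → f c ≡ 0) → ∑ (subsets n) f ≡ f Sub.⊥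
∑-subsets-empty zero    f h = ℕ.+-identityʳ _
∑-subsets-empty (suc n) f h = trans (∑-++ (map (outside ∷_) (subsets n)) (map (inside ∷_) (subsets n)) f)
  (trans (cong₂ _+_
      (trans (∑-map (outside ∷_) (subsets n) f)
        (∑-subsets-empty n (f ∘ (outside ∷_)) λ c (i , i∈) → h (outside ∷ c) (suc i , there i∈)))
      (trans (∑-map (inside ∷_) (subsets n) f) (∑-zero (subsets n) λ {c} _ → h (inside ∷ c) (zero , here))))
    (ℕ.+-identityʳ _))

Disjoint-sym : ∀ {n} {p q : Subset n} → Disjoint p q → Disjoint q p
Disjoint-sym {p = p} {q} d (x , x∈) with i , j ← Sub.x∈p∩q⁻ q p x∈ = d (x , Sub.x∈p∩q⁺ (j , i))

⋃-⊆ : ∀ {n} {ps qs : List (Subset n)} → ps ↭ qs → ⋃ ps Sub.⊆ ⋃ qs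
⋃-⊆ {ps = ps} r x∈ with p , p∈ , x∈p ← ∈-⋃⁻ ps x∈ = ∈-⋃⁺ (∈-resp-↭ r p∈) x∈p

partition-↭ : ∀ {n} {bs cs : List (Subset n)} → bs ↭ cs → IsSetPartition bs → IsSetPartition cs
partition-↭ r (ne , disj , cover) =
    All-resp-↭ r ne
  , AllPairs-resp-↭ (setoid _) Disjoint-sym (resp₂ Disjoint) (↭⇒↭ₛ r) disj
  , trans (sym (Sub.⊆-antisym (⋃-⊆ r) (⋃-⊆ (↭-sym r)))) cover

-- The indicator of being a set partition.
weight : ∀ {n} → List (Subset n) → ℕ
weight bs = ⟦ does (isSetPartition? bs) ⟧

weight-⇔ : ∀ {m n} {bs : List (Subset m)} {cs : List (Subset n)} →
  (IsSetPartition bs → IsSetPartition cs) → (IsSetPartition cs → IsSetPartition bs) → weight bs ≡ weight cs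
weight-⇔ {bs = bs} {cs} to from =
  cong ⟦_⟧ (does-⇔ (mk⇔ to from) (isSetPartition? bs) (isSetPartition? cs))

weight-↭ : ∀ {n} {bs cs : List (Subset n)} → bs ↭ cs → weight bs ≡ weight cs
weight-↭ {bs = bs} {cs} r = weight-⇔ {bs = bs} {cs} (partition-↭ r) (partition-↭ (↭-sym r))

weight-zero : ∀ {n} (bs : List (Subset n)) → ¬ IsSetPartition bs → weight bs ≡ 0
weight-zero bs h = cong ⟦_⟧ (dec-false (isSetPartition? bs) h)

stirling₂-∑ : ∀ n k → stirling₂ n k ≡ ∑ (choose k (subsets n)) weight
stirling₂-∑ n k = count-∑ isSetPartition? (choose k (subsets n))

module _ {n : ℕ} where

  ⋃-outside : (bs : List (Subset n)) → ⋃ (map (outside ∷_) bs) ≡ outside ∷ ⋃ bs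
  ⋃-outside []       = refl
  ⋃-outside (b ∷ bs) = cong ((outside ∷ b) ∪_) (⋃-outside bs)

  disjoint-∷⁻ : ∀ s t {p q : Subset n} → Disjoint (s ∷ p) (t ∷ q) → Disjoint p q
  disjoint-∷⁻ s t d (x , x∈) = d (suc x , there x∈)

  disjoint-∷⁺ : ∀ s {p q : Subset n} → Disjoint p q → Disjoint (s ∷ p) (outside ∷ q)
  disjoint-∷⁺ inside  d (suc x , there x∈) = d (x , x∈)
  disjoint-∷⁺ outside d (suc x , there x∈) = d (x , x∈)

  -- What it means for inside ∷ c and the sets outside ∷ b, with b in bs, to form a set partition; the
  -- set c may be empty.
  Tail : (c : Subset n) (bs : List (Subset n)) → Set
  Tail c bs = All Nonempty bs × All (Disjoint c) bs × AllPairs Disjoint bs × c ∪ ⋃ bs ≡ Sub.⊤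

  tail⁻ : ∀ {c bs} → IsSetPartition ((inside ∷ c) ∷ map (outside ∷_) bs) → Tail c bs
  tail⁻ {c} {bs} (_ ∷ ne , away ∷ disj , cover) =
      All.map (λ { (suc x , there x∈) → x , x∈ }) (All.map⁻ ne)
    , All.map (disjoint-∷⁻ inside outside) (All.map⁻ away)
    , AllPairs.map (disjoint-∷⁻ outside outside) (AllPairs.map⁻ disj)
    , Vec.∷-injectiveʳ (trans (sym (cong ((inside ∷ c) ∪_) (⋃-outside bs))) cover)

  tail⁺ : ∀ {c bs} → Tail c bs → IsSetPartition ((inside ∷ c) ∷ map (outside ∷_) bs)
  tail⁺ {c} {bs} (ne , away , disj , cover) =
      (zero , here) ∷ All.map⁺ (All.map (λ (x , x∈) → suc x , there x∈) ne)
    , All.map⁺ (All.map (disjoint-∷⁺ inside) away) ∷ AllPairs.map⁺ (AllPairs.map (disjoint-∷⁺ outside) disj)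
    , trans (cong ((inside ∷ c) ∪_) (⋃-outside bs)) (cong (inside ∷_) cover)

  weight-nonempty : ∀ {c bs} → Nonempty c → weight ((inside ∷ c) ∷ map (outside ∷_) bs) ≡ weight (c ∷ bs)
  weight-nonempty {c} {bs} ne = weight-⇔ {bs = (inside ∷ c) ∷ map (outside ∷_) bs} {c ∷ bs}
    (λ p → let (nes , away , disj , cover) = tail⁻ p in ne ∷ nes , away ∷ disj , cover)
    (λ { (_ ∷ nes , away ∷ disj , cover) → tail⁺ (nes , away , disj , cover) })

  weight-empty : ∀ bs → weight ((inside ∷ Sub.⊥) ∷ map (outside ∷_) bs) ≡ weight bs
  weight-empty bs = weight-⇔ {bs = (inside ∷ Sub.⊥) ∷ map (outside ∷_) bs} {bs}
    (λ p → let (nes , _ , disj , cover) = tail⁻ p in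
      nes , disj , trans (sym (Sub.∪-identityˡ (⋃ bs))) cover)
    (λ (nes , disj , cover) → tail⁺
      ( nes , All.tabulate (λ {b} _ (x , x∈) → Sub.∉⊥ (proj₁ (Sub.x∈p∩q⁻ Sub.⊥ b x∈)))
      , disj , trans (Sub.∪-identityˡ (⋃ bs)) cover))

  -- Here c is the block of zero, without zero.  If c is empty, the other blocks alone form a partition;
  -- otherwise they do so together with c.
  ∑-block-of-zero : (bs : List (Subset n)) →
    ∑ (subsets n) (λ c → weight (map (outside ∷_) bs ++ (inside ∷ c) ∷ []))
      ≡ weight bs + ∑ (subsets n) (λ c → weight (c ∷ bs))
  ∑-block-of-zero bs = begin
    ∑ (subsets n) (λ c → weight (map (outside ∷_) bs ++ (inside ∷ c) ∷ []))
      ≡⟨ ∑-cong (subsets n) (λ {c} _ → trans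
           (weight-↭ {bs = map (outside ∷_) bs ++ (inside ∷ c) ∷ []}
             (↭-sym (∷↭∷ʳ (inside ∷ c) (map (outside ∷_) bs))))
           (split c (Sub.nonempty? c))) ⟩
    ∑ (subsets n) (λ c → alone c + weight (c ∷ bs))
      ≡⟨ ∑-+ (subsets n) alone (λ c → weight (c ∷ bs)) ⟩
    ∑ (subsets n) alone + ∑ (subsets n) (λ c → weight (c ∷ bs))
      ≡⟨ cong (_+ ∑ (subsets n) (λ c → weight (c ∷ bs))) (trans (∑-subsets-empty n alone alone-nonempty) alone-⊥) ⟩
    weight bs + ∑ (subsets n) (λ c → weight (c ∷ bs)) ∎
    where
    open ≡-Reasoning
    -- The contribution of the empty set c.
    alone : Subset n → ℕ
    alone c = if does (Sub.nonempty? c) then 0 else weight bs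
    alone-nonempty : ∀ c → Nonempty c → alone c ≡ 0
    alone-nonempty c ne = cong (if_then 0 else weight bs) (dec-true (Sub.nonempty? c) ne)
    alone-⊥ : alone Sub.⊥ ≡ weight bs
    alone-⊥ = cong (if_then 0 else weight bs) (dec-false (Sub.nonempty? {n} Sub.⊥) λ (x , x∈) → Sub.∉⊥ x∈)
    split : ∀ c (d : Dec (Nonempty c)) → weight ((inside ∷ c) ∷ map (outside ∷_) bs)
      ≡ (if does d then 0 else weight bs) + weight (c ∷ bs)
    split c (yes ne) = weight-nonempty {c} {bs} ne
    split c (no  e) with refl ← Sub.Empty-unique e =
      trans (weight-empty bs) (sym (trans
        (cong (weight bs +_) (weight-zero (Sub.⊥ ∷ bs) λ { (ne ∷ _ , _) → e ne })) (ℕ.+-identityʳ _)))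

  -- Exactly one block of a partition contains zero.
  weight-one-inside : ∀ (as bs : List (Subset n)) → length bs ≢ 1 →
    weight (map (outside ∷_) as ++ map (inside ∷_) bs) ≡ 0
  weight-one-inside as [] _ = weight-zero (map (outside ∷_) as ++ []) λ (_ , _ , cover) → uncovered (trans (sym (trans
    (cong ⋃ (List.++-identityʳ (map (outside ∷_) as))) (⋃-outside as))) cover)
    where
    uncovered : ∀ {u : Subset n} → outside ∷ u ≢ Sub.⊤
    uncovered ()
  weight-one-inside as (b ∷ []) h = contradiction refl h
  weight-one-inside as (b ∷ c ∷ bs) _ = weight-zero (map (outside ∷_) as ++ map (inside ∷_) (b ∷ c ∷ bs)) λ p →
    clash (proj₁ (proj₂ (partition-↭
    (++-comm (map (outside ∷_) as) (map (inside ∷_) (b ∷ c ∷ bs))) p)))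
    where
    clash : ∀ {ps} → ¬ AllPairs Disjoint ((inside ∷ b) ∷ (inside ∷ c) ∷ ps)
    clash ((d ∷ _) ∷ _) = d (zero , here)

-- The recurrence of the Stirling numbers of the second kind

stirling₂-suc-zero : ∀ n → stirling₂ (suc n) 0 ≡ 0
stirling₂-suc-zero n = refl

-- The block of zero is singled out first; adding a nonempty block c to k other blocks is then turned
-- into singling out one of k + 1 blocks.
stirling₂-suc-suc : ∀ n k → stirling₂ (suc n) (suc k) ≡ stirling₂ n k + suc k * stirling₂ n (suc k)
stirling₂-suc-suc n k = begin
  stirling₂ (suc n) (suc k)
    ≡⟨ stirling₂-∑ (suc n) (suc k) ⟩
  ∑ (choose (suc k) (subsets (suc n))) weight
    ≡⟨ ∑-choose-split (outside ∷_) (inside ∷_) k (subsets n) (subsets n) weight weight-one-inside ⟩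
  ∑ (choose k (subsets n)) (λ bs → ∑ (subsets n) (λ c → weight (map (outside ∷_) bs ++ (inside ∷ c) ∷ [])))
    ≡⟨ ∑-cong (choose k (subsets n)) (λ {bs} _ → ∑-block-of-zero bs) ⟩
  ∑ (choose k (subsets n)) (λ bs → weight bs + ∑ (subsets n) (λ c → weight (c ∷ bs)))
    ≡⟨ ∑-+ (choose k (subsets n)) weight (λ bs → ∑ (subsets n) (λ c → weight (c ∷ bs))) ⟩
  ∑ (choose k (subsets n)) weight + ∑ (choose k (subsets n)) (λ bs → ∑ (subsets n) (λ c → weight (c ∷ bs)))
    ≡⟨ cong₂ _+_ (stirling₂-∑ n k) (∑-choose-picks k (subsets n) (λ c bs → weight (c ∷ bs)) repeated) ⟨
  stirling₂ n k + ∑ (choose (suc k) (subsets n)) (λ bs → ∑ (picks bs) (λ (c , r) → weight (c ∷ r)))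
    ≡⟨ cong (stirling₂ n k +_) (∑-cong (choose (suc k) (subsets n)) pick-any) ⟩
  stirling₂ n k + ∑ (choose (suc k) (subsets n)) (λ bs → suc k * weight bs)
    ≡⟨ cong (stirling₂ n k +_) (∑-* (suc k) (choose (suc k) (subsets n)) weight) ⟩
  stirling₂ n k + suc k * ∑ (choose (suc k) (subsets n)) weight
    ≡⟨ cong (λ s → stirling₂ n k + suc k * s) (stirling₂-∑ n (suc k)) ⟨
  stirling₂ n k + suc k * stirling₂ n (suc k) ∎
  where
  open ≡-Reasoning
  repeated : ∀ (c : Subset n) bs → c ∈ bs → weight (c ∷ bs) ≡ 0
  repeated c bs c∈ = weight-zero (c ∷ bs) λ
    { ((x , x∈) ∷ _ , away ∷ _ , _) → All.lookup away c∈ (x , Sub.x∈p∩q⁺ (x∈ , x∈)) }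
  pick-any : ∀ {bs} → bs ∈ choose (suc k) (subsets n) →
    ∑ (picks bs) (λ (c , r) → weight (c ∷ r)) ≡ suc k * weight bs
  pick-any {bs} bs∈ = trans (∑-cong (picks bs) (λ i → weight-↭ (picks-↭ bs i)))
    (trans (∑-const (weight bs) (picks bs))
      (cong (_* weight bs) (trans (length-picks bs) (length-choose (suc k) (subsets n) bs∈))))

-- The number of ways of inserting elements one by one

-- The number of ways to insert n further elements so that there are k blocks in the end, when there are
-- b blocks now and a ways of joining.  With κ true every insertion adds a way of joining, as for
-- permutations; with κ false only the opening of a block does, as for set partitions.
paths : Bool → (a b n k : ℕ) → ℕ
paths κ a b zero    k = [ b ≟ k ]
paths κ a b (suc n) k = paths κ (suc a) (suc b) n k + a * paths κ (⟦ κ ⟧ + a) b n k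

-- For κ true the last of n + 1 insertions finds a + n ways of joining, whatever the earlier insertions were.
paths₁-last-zero : ∀ a b n → paths true a b (suc n) 0 ≡ (a + n) * paths true a b n 0
paths₁-last-zero a b zero    = cong (_* [ b ≟ 0 ]) (sym (ℕ.+-identityʳ a))
paths₁-last-zero a b (suc n) = trans
  (cong₂ (λ u v → u + a * v) (paths₁-last-zero (suc a) (suc b) n) (paths₁-last-zero (suc a) b n))
  (factor a n (paths true (suc a) (suc b) n 0) (paths true (suc a) b n 0))
  where
  factor : ∀ a n p q → (suc a + n) * p + a * ((suc a + n) * q) ≡ (a + suc n) * (p + a * q)
  factor = solve-∀

paths₁-last-suc : ∀ a b n k →
  paths true a b (suc n) (suc k) ≡ paths true a b n k + (a + n) * paths true a b n (suc k)
paths₁-last-suc a b zero    k = cong (λ c → [ b ≟ k ] + c * [ b ≟ suc k ]) (sym (ℕ.+-identityʳ a))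
paths₁-last-suc a b (suc n) k = trans
  (cong₂ (λ u v → u + a * v) (paths₁-last-suc (suc a) (suc b) n k) (paths₁-last-suc (suc a) b n k))
  (factor a n (paths true (suc a) (suc b) n k) (paths true (suc a) (suc b) n (suc k))
    (paths true (suc a) b n k) (paths true (suc a) b n (suc k)))
  where
  factor : ∀ a n p p′ q q′ → p + (suc a + n) * p′ + a * (q + (suc a + n) * q′)
    ≡ p + a * q + (a + suc n) * (p′ + a * q′)
  factor = solve-∀

-- For κ false the ways of joining are the blocks, so that a and b agree throughout, and the last
-- insertion, if it joins, joins one of the blocks that there are in the end.
paths₂-last-zero : ∀ b n → paths false b b (suc n) 0 ≡ 0
paths₂-last-zero zero    zero    = refl
paths₂-last-zero (suc b) zero    = ℕ.*-zeroʳ b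
paths₂-last-zero b       (suc n) = trans
  (cong₂ (λ u v → u + b * v) (paths₂-last-zero (suc b) n) (paths₂-last-zero b n)) (ℕ.*-zeroʳ b)

paths₂-last-suc : ∀ b n k →
  paths false b b (suc n) (suc k) ≡ paths false b b n k + suc k * paths false b b n (suc k)
paths₂-last-suc b zero k = cong ([ b ≟ k ] +_) (replace b (suc k))
  where
  replace : ∀ m n → m * [ m ≟ n ] ≡ n * [ m ≟ n ]
  replace m n with m ≡ᵇ n in e
  ... | true  = cong (_* 1) (ℕ.≡ᵇ⇒≡ m n (subst T (sym e) tt))
  ... | false = trans (ℕ.*-zeroʳ m) (sym (ℕ.*-zeroʳ n))
paths₂-last-suc b (suc n) k = trans
  (cong₂ (λ u v → u + b * v) (paths₂-last-suc (suc b) n k) (paths₂-last-suc b n k))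
  (factor b (suc k) (paths false (suc b) (suc b) n k) (paths false (suc b) (suc b) n (suc k))
    (paths false b b n k) (paths false b b n (suc k)))
  where
  factor : ∀ b l p p′ q q′ → p + l * p′ + b * (q + l * q′) ≡ p + b * q + l * (p′ + b * q′)
  factor = solve-∀

paths≡stirling₁ : ∀ n k → paths true 0 0 n k ≡ stirling₁ n k
paths≡stirling₁ zero    zero    = refl
paths≡stirling₁ zero    (suc k) = refl
paths≡stirling₁ (suc n) zero    = trans (paths₁-last-zero 0 0 n)
  (trans (cong (n *_) (paths≡stirling₁ n 0)) (sym (stirling₁-suc-zero n)))
paths≡stirling₁ (suc n) (suc k) = trans (paths₁-last-suc 0 0 n k)
  (trans (cong₂ (λ u v → u + n * v) (paths≡stirling₁ n k) (paths≡stirling₁ n (suc k)))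
    (sym (stirling₁-suc-suc n k)))

paths≡stirling₂ : ∀ n k → paths false 0 0 n k ≡ stirling₂ n k
paths≡stirling₂ zero    zero    = refl
paths≡stirling₂ zero    1       = refl
paths≡stirling₂ zero    (suc (suc k)) = refl
paths≡stirling₂ (suc n) zero    = trans (paths₂-last-zero 0 n) (sym (stirling₂-suc-zero n))
paths≡stirling₂ (suc n) (suc k) = trans (paths₂-last-suc 0 n k)
  (trans (cong₂ (λ u v → u + suc k * v) (paths≡stirling₂ n k) (paths≡stirling₂ n (suc k)))
    (sym (stirling₂-suc-suc n k)))

-- Heads sweeping over tapes

module _ {A : Set} where

  -- The tape listed by ls, outwards from the head, and xs ++ [ e ], with the head on the first cell of the
  -- latter.
  scan : List A → List A → A → Tape A
  scan ls []       e = tape ls e []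
  scan ls (x ∷ xs) e = tape ls x (xs ++ [ e ])

  moveBounded-right : ∀ ls x xs e →
    moveBounded right (scan ls (x ∷ xs) e) ≡ scan (x ∷ ls) xs e
  moveBounded-right ls x []       e = refl
  moveBounded-right ls x (y ∷ xs) e = refl

  moveUnbounded-right : ∀ b a ls x xs e →
    moveUnbounded b right (write a (scan ls (x ∷ xs) e)) ≡ scan (a ∷ ls) xs e
  moveUnbounded-right b a ls x []       e = refl
  moveUnbounded-right b a ls x (y ∷ xs) e = refl

-- Computation trees

module Counting (M : NTM) where
  open NTM M
  open Semantics M
  open Config

  -- The computation tree of c is finite, its configurations have space at most s, and it has n accepting
  -- leaves.  A machine with at most two actions in each situation needs no further constructors.
  data Counts (s : ℕ) (c : Config) : ℕ → Set where
    halt : actions c ≡ [] → space c ≤ s →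
           Counts s c ⟦ accepting (state c) ⟧
    next : ∀ {t n} → actions c ≡ [ t ] → space c ≤ s →
           Counts s (apply t c) n → Counts s c n
    fork : ∀ {t u m n} → actions c ≡ t ∷ u ∷ [] → space c ≤ s →
           Counts s (apply t c) m → Counts s (apply u c) n → Counts s c (m + n)

  counts⇒halts : ∀ {s c n} → Counts s c n → Halts c
  counts⇒halts (halt e _) = acc λ { (t , t∈ , refl) → contradiction (subst (t ∈_) e t∈) λ () }
  counts⇒halts {c = c} (next {t} e _ p) =
    acc λ { (u , u∈ , refl) → only (subst (u ∈_) e u∈) }
    where
    only : ∀ {u} → u ∈ [ t ] → Halts (apply u c)
    only (here refl) = counts⇒halts p
  counts⇒halts {c = c} (fork {t} {u} e _ p q) =
    acc λ { (v , v∈ , refl) → either (subst (v ∈_) e v∈) }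
    where
    either : ∀ {v} → v ∈ t ∷ u ∷ [] → Halts (apply v c)
    either (here refl)         = counts⇒halts p
    either (there (here refl)) = counts⇒halts q

  counts⇒space : ∀ {s c d n} → Counts s c n → Star _⟶_ c d → space d ≤ s
  counts⇒space (halt _ b)     ε = b
  counts⇒space (next _ b _)   ε = b
  counts⇒space (fork _ b _ _) ε = b
  counts⇒space (halt e _) ((t , t∈ , refl) ◅ _) with subst (t ∈_) e t∈
  ... | ()
  counts⇒space (next e _ p) ((t , t∈ , refl) ◅ r) with subst (t ∈_) e t∈
  ... | here refl = counts⇒space p r
  counts⇒space (fork e _ p q) ((t , t∈ , refl) ◅ r) with subst (t ∈_) e t∈
  ... | here refl         = counts⇒space p r
  ... | there (here refl) = counts⇒space q r

  -- AcceptingPath c with the list of actions made a parameter, so that it can be replaced by an equal one.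
  data Branch (c : Config) (as : List (Action State Symbol)) : Set where
    accept : T (null as) → T (accepting (state c)) → Branch c as
    step   : ∀ {t} → t ∈ as → AcceptingPath (apply t c) → Branch c as

  path↔branch : ∀ {c} → AcceptingPath c ↔ Branch c (actions c)
  path↔branch = mk↔ₛ′
    (λ { (accept h a) → accept h a ; (step i p) → step i p })
    (λ { (accept h a) → accept h a ; (step i p) → step i p })
    (λ { (accept h a) → refl ; (step i p) → refl })
    (λ { (accept h a) → refl ; (step i p) → refl })

  accept↔Fin : ∀ b → T b ↔ Fin ⟦ b ⟧
  accept↔Fin true  = ↔-sym Fin.1↔⊤
  accept↔Fin false = ↔-sym Fin.0↔⊥

  counts⇒paths : ∀ {s c n} → Counts s c n → AcceptingPath c ↔ Fin n
  counts⇒paths {c = c} (halt e _) =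
    ↔-trans (subst (λ as → AcceptingPath c ↔ Branch c as) e path↔branch)
      (↔-trans none (accept↔Fin (accepting (state c))))
    where
    none : Branch c [] ↔ T (accepting (state c))
    none = mk↔ₛ′ (λ { (accept _ a) → a }) (accept tt) (λ _ → refl)
      (λ { (accept tt _) → refl })
  counts⇒paths {c = c} (next {t} e _ p) =
    ↔-trans (subst (λ as → AcceptingPath c ↔ Branch c as) e path↔branch)
      (↔-trans one (counts⇒paths p))
    where
    one : Branch c [ t ] ↔ AcceptingPath (apply t c)
    one = mk↔ₛ′ (λ { (step (here refl) p) → p }) (step (here refl)) (λ _ → refl)
      (λ { (step (here refl) p) → refl })
  counts⇒paths {c = c} (fork {t} {u} e _ p q) =
    ↔-trans (subst (λ as → AcceptingPath c ↔ Branch c as) e path↔branch)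
      (↔-trans two (↔-trans (counts⇒paths p ⊎-↔ counts⇒paths q) (↔-sym Fin.+↔⊎)))
    where
    two : Branch c (t ∷ u ∷ []) ↔ (AcceptingPath (apply t c) ⊎ AcceptingPath (apply u c))
    two = mk↔ₛ′
      (λ { (step (here refl) p) → inj₁ p ; (step (there (here refl)) p) → inj₂ p })
      (λ { (inj₁ p) → step (here refl) p ; (inj₂ p) → step (there (here refl)) p })
      (λ { (inj₁ p) → refl ; (inj₂ p) → refl })
      (λ { (step (here refl) p) → refl ; (step (there (here refl)) p) → refl })

-- Finite sets

⊤-finite : IsFinite ⊤
⊤-finite = 1 , ↔-sym Fin.1↔⊤

Bool-finite : IsFinite Bool
Bool-finite = 2 , ↔-sym Fin.2↔Bool

⊎-finite : ∀ {A B} → IsFinite A → IsFinite B → IsFinite (A ⊎ B)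
⊎-finite (m , f) (n , g) = m + n , ↔-trans (f ⊎-↔ g) (↔-sym Fin.+↔⊎)

×-finite : ∀ {A B} → IsFinite A → IsFinite B → IsFinite (A × B)
×-finite (m , f) (n , g) = m * n , ↔-trans (f ×-↔ g) (↔-sym Fin.*↔×)

finite-via : ∀ {A B} → A ↔ B → IsFinite B → IsFinite A
finite-via f (n , g) = n , ↔-trans f g

Maybe-finite : ∀ {A} → IsFinite A → IsFinite (Maybe A)
Maybe-finite F = finite-via iso (⊎-finite ⊤-finite F)
  where
  iso : Maybe _ ↔ (⊤ ⊎ _)
  iso = mk↔ₛ′ (λ { nothing → inj₁ tt ; (just x) → inj₂ x })
    (λ { (inj₁ tt) → nothing ; (inj₂ x) → just x })
    (λ { (inj₁ tt) → refl ; (inj₂ x) → refl })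
    (λ { nothing → refl ; (just x) → refl })

-- The machine

-- Reading 1ⁿ before the 0, or 1ᵏ after it.
data Phase : Set where
  building checking : Phase

-- In the state home p the work head is on the least significant cell, or on a blank if there are no
-- cells, and the input head on the next symbol to be read; return p moves the work head back there and
-- then advances the input head.  The other states belong to sweeps over the counters towards the most
-- significant cell:
--   increment adds its two carry bits to the counters A and B;
--   guess chooses a number, of which less says whether the bits chosen so far make it less than A,
--     and adds the carry bit to A in the same sweep;
--   decrement subtracts the borrow bit from B, with final set when the input has been read completely.
-- The flag lastGuess keeps the two guesses apart as actions even when they have the same effect.
data State : Set where
  start       : State
  home return : Phase → State
  increment   : (carryA carryB : Bool) → State
  guess       : (less carryA lastGuess : Bool) → State
  decrement   : (final borrow : Bool) → State

Phase-finite : IsFinite Phase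
Phase-finite = finite-via
  (mk↔ₛ′ (λ { building → false ; checking → true }) (λ { false → building ; true → checking })
    (λ { false → refl ; true → refl }) (λ { building → refl ; checking → refl }))
  Bool-finite

State-finite : IsFinite State
State-finite = finite-via (mk↔ₛ′ to from to-from from-to)
  (⊎-finite ⊤-finite (⊎-finite Phase-finite (⊎-finite Phase-finite
    (⊎-finite (×-finite Bool-finite Bool-finite)
      (⊎-finite (×-finite Bool-finite (×-finite Bool-finite Bool-finite))
        (×-finite Bool-finite Bool-finite))))))
  where
  Code : Set
  Code = ⊤ ⊎ Phase ⊎ Phase ⊎ (Bool × Bool) ⊎ (Bool × Bool × Bool) ⊎ (Bool × Bool)
  to : State → Code
  to start           = inj₁ tt
  to (home p)        = inj₂ (inj₁ p)
  to (return p)      = inj₂ (inj₂ (inj₁ p))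
  to (increment a b) = inj₂ (inj₂ (inj₂ (inj₁ (a , b))))
  to (guess l a g)   = inj₂ (inj₂ (inj₂ (inj₂ (inj₁ (l , a , g)))))
  to (decrement f c) = inj₂ (inj₂ (inj₂ (inj₂ (inj₂ (f , c)))))
  from : Code → State
  from (inj₁ tt)                                        = start
  from (inj₂ (inj₁ p))                                  = home p
  from (inj₂ (inj₂ (inj₁ p)))                           = return p
  from (inj₂ (inj₂ (inj₂ (inj₁ (a , b)))))              = increment a b
  from (inj₂ (inj₂ (inj₂ (inj₂ (inj₁ (l , a , g))))))   = guess l a g
  from (inj₂ (inj₂ (inj₂ (inj₂ (inj₂ (f , c))))))       = decrement f c
  to-from : ∀ x → to (from x) ≡ x
  to-from (inj₁ tt)                                      = refl
  to-from (inj₂ (inj₁ p))                                = refl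
  to-from (inj₂ (inj₂ (inj₁ p)))                         = refl
  to-from (inj₂ (inj₂ (inj₂ (inj₁ (a , b)))))            = refl
  to-from (inj₂ (inj₂ (inj₂ (inj₂ (inj₁ (l , a , g)))))) = refl
  to-from (inj₂ (inj₂ (inj₂ (inj₂ (inj₂ (f , c))))))     = refl
  from-to : ∀ q → from (to q) ≡ q
  from-to start           = refl
  from-to (home p)        = refl
  from-to (return p)      = refl
  from-to (increment a b) = refl
  from-to (guess l a g)   = refl
  from-to (decrement f c) = refl

-- One binary digit of A and one of B; the blank symbol is nothing.
Cell : Set
Cell = Bool × Bool

-- Comparison of two numbers, from the least significant bit on: a guessed bit g and a bit a of A decide
-- unless they agree, in which case the comparison of the lower bits stands.
below : (g a less : Bool) → Bool
below false false less = less
below false true  less = true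
below true  false less = false
below true  true  less = less

-- The only accepting state.  At a blank it is halting, and then the subtraction made at the right
-- endmarker has failed, so that B is 0.
isUnderflow : State → Bool
isUnderflow (decrement true true) = true
isUnderflow _                     = false

-- A sweep that ends with a pending carry writes one more cell.  A guess that is not less than A ends in
-- a rejecting halt, and so do a subtraction from 0 before the right endmarker and a letter 0 or a right
-- endmarker where they make the input ill-formed.  The subtraction at the right endmarker ends in an
-- accepting halt if it is from 0 and in a rejecting one otherwise.
transitions : Bool → State → InputSymbol → Maybe Cell → List (Action State (Maybe Cell))
transitions κ start x s = [ action (home building) s right right ]
transitions κ (home building) (bit true) s =
  action (increment true true) s stay stay ∷ action (guess false κ false) s stay stay ∷ []
transitions κ (home building) (bit false) s = [ action (home checking) s right stay ]
transitions κ (home building) _ s = []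
transitions κ (increment ca cb) x (just (a , b)) =
  [ action (increment (a ∧ ca) (b ∧ cb)) (just (a xor ca , b xor cb)) stay right ]
transitions κ (increment false false) x nothing = [ action (return building) nothing stay left ]
transitions κ (increment ca cb) x nothing =
  [ action (increment false false) (just (ca , cb)) stay right ]
transitions κ (guess l ca g) x (just (a , b)) =
  action (guess (below false a l) (a ∧ ca) false) (just (a xor ca , b)) stay right ∷
  action (guess (below true  a l) (a ∧ ca) true ) (just (a xor ca , b)) stay right ∷ []
transitions κ (guess true  ca g) x nothing = [ action (increment ca false) nothing stay stay ]
transitions κ (guess false ca g) x nothing = []
transitions κ (return p) x (just ab) = [ action (return p) (just ab) stay left ]
transitions κ (return p) x nothing   = [ action (home p) nothing right right ]
transitions κ (home checking) (bit true) s  = [ action (decrement false true) s stay stay ]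
transitions κ (home checking) (bit false) s = []
transitions κ (home checking) ⊣ s = [ action (decrement true true) s stay stay ]
transitions κ (home checking) ⊢ s = []
transitions κ (decrement f c) x (just (a , b)) =
  [ action (decrement f (not b ∧ c)) (just (a , b xor c)) stay right ]
transitions κ (decrement false false) x nothing = [ action (return checking) nothing stay left ]
transitions κ (decrement _ _) x nothing = []

transitions-unique : ∀ κ q x s → List.Unique (transitions κ q x s)
transitions-unique κ start x s = [] ∷ []
transitions-unique κ (home building) (bit true)  s = ((λ ()) ∷ []) ∷ [] ∷ []
transitions-unique κ (home building) (bit false) s = [] ∷ []
transitions-unique κ (home building) ⊢ s = []
transitions-unique κ (home building) ⊣ s = []
transitions-unique κ (increment ca cb) x (just _) = [] ∷ []
transitions-unique κ (increment false false) x nothing = [] ∷ []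
transitions-unique κ (increment false true ) x nothing = [] ∷ []
transitions-unique κ (increment true  cb   ) x nothing = [] ∷ []
transitions-unique κ (guess l ca g) x (just _) = ((λ ()) ∷ []) ∷ [] ∷ []
transitions-unique κ (guess true  ca g) x nothing = [] ∷ []
transitions-unique κ (guess false ca g) x nothing = []
transitions-unique κ (return p) x (just _) = [] ∷ []
transitions-unique κ (return p) x nothing  = [] ∷ []
transitions-unique κ (home checking) (bit true)  s = [] ∷ []
transitions-unique κ (home checking) (bit false) s = []
transitions-unique κ (home checking) ⊢ s = []
transitions-unique κ (home checking) ⊣ s = [] ∷ []
transitions-unique κ (decrement f c) x (just _) = [] ∷ []
transitions-unique κ (decrement false false) x nothing = [] ∷ []
transitions-unique κ (decrement false true)  x nothing = []
transitions-unique κ (decrement true  c)     x nothing = []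

machine : Bool → NTM
machine κ = record
  { State = State ; state-finite = State-finite
  ; Symbol = Maybe Cell
  ; symbol-finite = Maybe-finite (×-finite Bool-finite Bool-finite)
  ; blank = nothing ; start = start ; accepting = isUnderflow
  ; δ = transitions κ ; δ-unique = transitions-unique κ }

-- Binary arithmetic on two tracks

-- The number written on the track p, with the least significant digit first.
value : (Cell → Bool) → List Cell → ℕ
value p []       = 0
value p (x ∷ xs) = ⟦ p x ⟧ + 2 * value p xs

-- The cells after a sweep of increment.  They are one more if a carry remains at the end.
add : (carryA carryB : Bool) → List Cell → List Cell
add ca    cb    ((a , b) ∷ xs) = (a xor ca , b xor cb) ∷ add (a ∧ ca) (b ∧ cb) xs
add false false []             = []
add ca    cb    []             = [ (ca , cb) ]

-- The cells after a sweep of decrement, and the borrow bit with which it ends.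
subtract : (borrow : Bool) → List Cell → List Cell
subtract c []             = []
subtract c ((a , b) ∷ xs) = (a , b xor c) ∷ subtract (not b ∧ c) xs

borrowOut : (borrow : Bool) → List Cell → Bool
borrowOut c []             = c
borrowOut c ((a , b) ∷ xs) = borrowOut (not b ∧ c) xs

half-adder : ∀ a c → ⟦ a xor c ⟧ + 2 * ⟦ a ∧ c ⟧ ≡ ⟦ c ⟧ + ⟦ a ⟧
half-adder false false = refl
half-adder false true  = refl
half-adder true  false = refl
half-adder true  true  = refl

ripple : ∀ a c v w → w ≡ ⟦ a ∧ c ⟧ + v → ⟦ a xor c ⟧ + 2 * w ≡ ⟦ c ⟧ + (⟦ a ⟧ + 2 * v)
ripple a c v w refl = trans (regroup ⟦ a xor c ⟧ ⟦ a ∧ c ⟧ v)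
  (trans (cong (_+ 2 * v) (half-adder a c)) (ℕ.+-assoc ⟦ c ⟧ ⟦ a ⟧ (2 * v)))
  where
  regroup : ∀ x y v → x + 2 * (y + v) ≡ (x + 2 * y) + 2 * v
  regroup = solve-∀

carry-≤ : ∀ a c v → 2 * (⟦ a ∧ c ⟧ + v) ≤ ⟦ c ⟧ + (⟦ a ⟧ + 2 * v)
carry-≤ a c v = ℕ.≤-trans (ℕ.m≤n+m _ ⟦ a xor c ⟧) (ℕ.≤-reflexive (ripple a c v _ refl))

value-addA : ∀ ca cb xs → value proj₁ (add ca cb xs) ≡ ⟦ ca ⟧ + value proj₁ xs
value-addA false false [] = refl
value-addA false true  [] = refl
value-addA true  cb    [] = refl
value-addA ca cb ((a , b) ∷ xs) = ripple a ca _ _ (value-addA (a ∧ ca) (b ∧ cb) xs)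

value-addB : ∀ ca cb xs → value proj₂ (add ca cb xs) ≡ ⟦ cb ⟧ + value proj₂ xs
value-addB false false [] = refl
value-addB false true  [] = refl
value-addB true  false [] = refl
value-addB true  true  [] = refl
value-addB ca cb ((a , b) ∷ xs) = ripple b cb _ _ (value-addB (a ∧ ca) (b ∧ cb) xs)

-- A new cell is written only if one of the two sums needs it.
length-add : ∀ ca cb xs →
  length (add ca cb xs) ≡ length xs
  ⊎ 2 ^ length (add ca cb xs) ≤ 2 * (⟦ ca ⟧ + value proj₁ xs)
  ⊎ 2 ^ length (add ca cb xs) ≤ 2 * (⟦ cb ⟧ + value proj₂ xs)
length-add false false [] = inj₁ refl
length-add false true  [] = inj₂ (inj₂ ℕ.≤-refl)
length-add true  cb    [] = inj₂ (inj₁ ℕ.≤-refl)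
length-add ca cb ((a , b) ∷ xs) with length-add (a ∧ ca) (b ∧ cb) xs
... | inj₁ e        = inj₁ (cong suc e)
... | inj₂ (inj₁ h) = inj₂ (inj₁ (ℕ.*-monoʳ-≤ 2 (ℕ.≤-trans h (carry-≤ a ca _))))
... | inj₂ (inj₂ h) = inj₂ (inj₂ (ℕ.*-monoʳ-≤ 2 (ℕ.≤-trans h (carry-≤ b cb _))))

length-add-≥ : ∀ ca cb xs → length xs ≤ length (add ca cb xs)
length-add-≥ ca cb []             = z≤n
length-add-≥ ca cb ((a , b) ∷ xs) = s≤s (length-add-≥ (a ∧ ca) (b ∧ cb) xs)

length-subtract : ∀ c xs → length (subtract c xs) ≡ length xs
length-subtract c []             = refl
length-subtract c ((a , b) ∷ xs) = cong suc (length-subtract (not b ∧ c) xs)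

half-subtractor : ∀ b c v w → v ≡ ⟦ not b ∧ c ⟧ + w →
  ⟦ b ⟧ + 2 * v ≡ ⟦ c ⟧ + (⟦ b xor c ⟧ + 2 * w)
half-subtractor false false v w refl = refl
half-subtractor false true  v w refl = ℕ.*-suc 2 w
half-subtractor true  false v w refl = refl
half-subtractor true  true  v w refl = refl

-- The outcome of subtracting the bit c from v, where w is what remains on the track: the subtraction
-- is exact, or it asks for 1 when v is 0.  The index is the final borrow bit.
data Subtraction (c : Bool) (v w : ℕ) : Bool → Set where
  exact     : v ≡ ⟦ c ⟧ + w → Subtraction c v w false
  underflow : c ≡ true → v ≡ 0 → Subtraction c v w true

subtraction : ∀ c xs → Subtraction c (value proj₂ xs) (value proj₂ (subtract c xs)) (borrowOut c xs)
subtraction false [] = exact refl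
subtraction true  [] = underflow refl refl
subtraction c ((a , b) ∷ xs)
  with borrowOut (not b ∧ c) xs | subtraction (not b ∧ c) xs
... | _ | exact e = exact (half-subtractor b c _ _ e)
subtraction true ((a , false) ∷ xs) | _ | underflow e h = underflow refl (cong (2 *_) h)

-- Functions of strings

extendByZero-cong : ∀ {f g : ℕ → ℕ → ℕ} → (∀ n k → f n k ≡ g n k) →
  ∀ x → extendByZero f x ≡ extendByZero g x
extendByZero-cong h []          = refl
extendByZero-cong h (true ∷ x)  = extendByZero-cong (h ∘ suc) x
extendByZero-cong h (false ∷ x) = cong (if and x then_else 0) (h 0 (length x))

extendByZero-linear : ∀ f g c x →
  extendByZero (λ n k → f n k + c * g n k) x ≡ extendByZero f x + c * extendByZero g x
extendByZero-linear f g c []          = sym (ℕ.*-zeroʳ c)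
extendByZero-linear f g c (true ∷ x)  = extendByZero-linear (λ n → f (suc n)) (λ n → g (suc n)) c x
extendByZero-linear f g c (false ∷ x) with and x
... | true  = refl
... | false = sym (ℕ.*-zeroʳ c)

-- Execution of the machine

size : {A : Set} → Tape A → ℕ
size t = length (Tape.lefts t) + suc (length (Tape.rights t))

module Execution (κ : Bool) where
  open Semantics (machine κ)
  open Counting (machine κ)

  -- The work tape during a sweep: the counters rs ʳ++ xs between two blanks, with the head on the first
  -- cell of xs, or on the right blank when xs is empty.
  work : List Cell → List Cell → Tape (Maybe Cell)
  work rs xs = scan (map just rs ++ [ nothing ]) (map just xs) nothing

  -- The same tape with the head one cell further left, possibly on the left blank.
  workLeft : List Cell → List Cell → Tape (Maybe Cell)
  workLeft []       xs = tape [] nothing (map just xs ++ [ nothing ])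
  workLeft (r ∷ rs) xs = tape (map just rs ++ [ nothing ]) (just r) (map just xs ++ [ nothing ])

  length-end : ∀ (xs : List Cell) → length (map just xs ++ [ nothing ]) ≡ suc (length xs)
  length-end []       = refl
  length-end (x ∷ xs) = cong suc (length-end xs)

  length-between : ∀ (rs xs : List Cell) → suc (length rs) + suc (length xs) ≡ 2 + length (rs ʳ++ xs)
  length-between rs xs =
    cong suc (trans (ℕ.+-suc (length rs) (length xs)) (cong suc (sym (List.length-ʳ++ rs))))

  size-work : ∀ rs xs → size (work rs xs) ≡ 2 + length (rs ʳ++ xs)
  size-work rs []       = trans (cong (_+ 1) (length-end rs)) (length-between rs [])
  size-work rs (x ∷ xs) =
    trans (cong₂ (λ m n → m + suc n) (length-end rs) (length-end xs)) (length-between rs (x ∷ xs))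

  size-workLeft : ∀ rs xs → size (workLeft rs xs) ≡ 2 + length (rs ʳ++ xs)
  size-workLeft []       xs = cong suc (length-end xs)
  size-workLeft (r ∷ rs) xs =
    trans (cong₂ (λ m n → m + suc n) (length-end rs) (length-end xs)) (length-between rs (r ∷ xs))

  work-end : ∀ rs → moveUnbounded nothing left (work rs []) ≡ workLeft rs []
  work-end []       = refl
  work-end (r ∷ rs) = refl

  work-step : ∀ rs x y xs →
    moveUnbounded nothing right (write (just y) (work rs (x ∷ xs))) ≡ work (y ∷ rs) xs
  work-step rs x y xs =
    moveUnbounded-right nothing (just y) (map just rs ++ [ nothing ]) (just x) (map just xs) nothing

  module _ {s : ℕ} where
    infix 4 _↝_
    _↝_ : Config → ℕ → Set
    c ↝ n = Counts s c n

    recount : ∀ {c m n} → m ≡ n → c ↝ m → c ↝ n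
    recount refl p = p

    reinput : ∀ {q i j w n} → i ≡ j → config q i w ↝ n → config q j w ↝ n
    reinput refl p = p

    rework : ∀ {q i v w n} → v ≡ w → config q i v ↝ n → config q i w ↝ n
    rework refl p = p

    fits : ∀ rs xs → 2 + length (rs ʳ++ xs) ≤ s → size (work rs xs) ≤ s
    fits rs xs = subst (_≤ s) (sym (size-work rs xs))

    fitsLeft : ∀ rs xs → 2 + length (rs ʳ++ xs) ≤ s → size (workLeft rs xs) ≤ s
    fitsLeft rs xs = subst (_≤ s) (sym (size-workLeft rs xs))

    -- Room for the final counters is room for those in the middle of a sweep.
    shrink : ∀ rs {xs ys : List Cell} → length xs ≤ length ys →
      2 + length (rs ʳ++ ys) ≤ s → 2 + length (rs ʳ++ xs) ≤ s
    shrink rs {xs} {ys} h = ℕ.≤-trans (ℕ.+-monoʳ-≤ 2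
      (subst₂ _≤_ (sym (List.length-ʳ++ rs)) (sym (List.length-ʳ++ rs)) (ℕ.+-monoʳ-≤ (length rs) h)))

    -- Each of the following lemmas traces the computation backwards: it turns the count at the end of
    -- a sweep, or after it, into the count at its beginning.
    return-run : ∀ {p i n} rs xs → 2 + length (rs ʳ++ xs) ≤ s →
      config (home p) (moveBounded right i) (work [] (rs ʳ++ xs)) ↝ n →
      config (return p) i (workLeft rs xs) ↝ n
    return-run {p} {i} [] xs b r =
      next refl (fitsLeft [] xs b) (rework (sym (first xs)) r)
      where
      first : ∀ xs → moveUnbounded nothing right (workLeft [] xs) ≡ work [] xs
      first []       = refl
      first (x ∷ xs) = refl
    return-run {p} {i} (x ∷ rs) xs b r =
      next refl (fitsLeft (x ∷ rs) xs b)
        (rework (sym (back rs)) (return-run rs (x ∷ xs) b r))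
      where
      back : ∀ rs → moveUnbounded nothing left (workLeft (x ∷ rs) xs) ≡ workLeft rs (x ∷ xs)
      back []       = refl
      back (_ ∷ rs) = refl

    increment-run : ∀ {i n} ca cb rs xs → 2 + length (rs ʳ++ add ca cb xs) ≤ s →
      config (home building) (moveBounded right i) (work [] (rs ʳ++ add ca cb xs)) ↝ n →
      config (increment ca cb) i (work rs xs) ↝ n
    increment-run {i} ca cb rs (x@(a , b) ∷ xs) h r =
      next refl (fits rs (x ∷ xs) (shrink rs (length-add-≥ ca cb (x ∷ xs)) h))
        (rework (sym (work-step rs x _ xs))
          (increment-run (a ∧ ca) (b ∧ cb) ((a xor ca , b xor cb) ∷ rs) xs h r))
    increment-run {i} false false rs [] h r =
      next refl (fits rs [] h)
        (rework (sym (work-end rs)) (return-run rs [] h r))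
    increment-run {i} false true rs [] h r =
      next refl (fits rs [] (shrink rs (length-add-≥ false true []) h))
        (increment-run false false ((false , true) ∷ rs) [] h r)
    increment-run {i} true cb rs [] h r =
      next refl (fits rs [] (shrink rs (length-add-≥ true cb []) h))
        (increment-run false false ((true , cb) ∷ rs) [] h r)

    addA-cons : ∀ ca a b xs → add ca false ((a , b) ∷ xs) ≡ (a xor ca , b) ∷ add (a ∧ ca) false xs
    addA-cons ca a false xs = refl
    addA-cons ca a true  xs = refl

    -- Of all bit strings as long as the counters, those less than A survive, and the one equal to A in
    -- addition if less is set at the start: altogether ⟦ l ⟧ plus the value of A.  All of them continue
    -- in the same configuration.
    guess-run : ∀ {i n} l ca g rs xs → 2 + length (rs ʳ++ add ca false xs) ≤ s →
      config (home building) (moveBounded right i) (work [] (rs ʳ++ add ca false xs)) ↝ n →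
      config (guess l ca g) i (work rs xs) ↝ (⟦ l ⟧ + value proj₁ xs) * n
    guess-run {i} false ca g rs [] h r =
      halt refl (fits rs [] (shrink rs (length-add-≥ ca false []) h))
    guess-run {i} {n} true ca g rs [] h r =
      next refl (fits rs [] (shrink rs (length-add-≥ ca false []) h))
        (recount (sym (ℕ.+-identityʳ n)) (increment-run ca false rs [] h r))
    guess-run {i} {n} l ca g rs (x@(a , b) ∷ xs) h r =
      recount {c = config (guess l ca g) i (work rs (x ∷ xs))} (choices a l)
        (fork refl (fits rs (x ∷ xs) (shrink rs (length-add-≥ ca false (x ∷ xs)) h))
          (branch false) (branch true))
      where
      eq : rs ʳ++ add ca false (x ∷ xs) ≡ rs ʳ++ (a xor ca , b) ∷ add (a ∧ ca) false xs
      eq = cong (rs ʳ++_) (addA-cons ca a b xs)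
      branch : ∀ g → config (guess (below g a l) (a ∧ ca) g) i
        (moveUnbounded nothing right (write (just (a xor ca , b)) (work rs (x ∷ xs))))
        ↝ (⟦ below g a l ⟧ + value proj₁ xs) * n
      branch g = rework (sym (work-step rs x _ xs))
        (guess-run (below g a l) (a ∧ ca) g ((a xor ca , b) ∷ rs) xs
          (subst (λ zs → 2 + length zs ≤ s) eq h)
          (subst (λ zs → config (home building) (moveBounded right i) (work [] zs) ↝ n) eq r))
      odd : ∀ v n → (1 + v) * n + v * n ≡ (1 + 2 * v) * n
      odd = solve-∀
      choices : ∀ a l → (⟦ below false a l ⟧ + value proj₁ xs) * n + (⟦ below true a l ⟧ + value proj₁ xs) * n
        ≡ (⟦ l ⟧ + (⟦ a ⟧ + 2 * value proj₁ xs)) * n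
      choices false false = even (value proj₁ xs) n
        where
        even : ∀ v n → v * n + v * n ≡ (2 * v) * n
        even = solve-∀
      choices false true  = odd (value proj₁ xs) n
      choices true  false = odd (value proj₁ xs) n
      choices true true = even (value proj₁ xs) n
        where
        even : ∀ v n → (1 + v) * n + (1 + v) * n ≡ (2 + 2 * v) * n
        even = solve-∀

    decrement-run : ∀ {i n} f c rs xs → 2 + length (rs ʳ++ xs) ≤ s →
      config (decrement f (borrowOut c xs)) i (work (subtract c xs ʳ++ rs) []) ↝ n →
      config (decrement f c) i (work rs xs) ↝ n
    decrement-run f c rs [] h r = r
    decrement-run {i} f c rs (x@(a , b) ∷ xs) h r =
      next refl (fits rs (x ∷ xs) h)
        (rework (sym (work-step rs x _ xs))
          (decrement-run f (not b ∧ c) ((a , b xor c) ∷ rs) xs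
            (shrink rs ℕ.≤-refl h) r))

    double-reverse : ∀ (xs : List Cell) → (xs ʳ++ []) ʳ++ [] ≡ xs
    double-reverse xs = trans (List.ʳ++-ʳ++ xs) (List.++-identityʳ xs)

    subtract-fits : ∀ xs → 2 + length xs ≤ s → 2 + length ((subtract true xs ʳ++ []) ʳ++ []) ≤ s
    subtract-fits xs = subst (λ l → 2 + l ≤ s)
      (sym (trans (cong length (double-reverse (subtract true xs))) (length-subtract true xs)))

    -- The accepting paths from here are one or none, according to whether the rest of the input consists
    -- of as many ones as B says.
    checking-run : ∀ y ls xs → 2 + length xs ≤ s →
      config (home checking) (scan ls (map bit y) ⊣) (work [] xs)
        ↝ (if and y then [ value proj₂ xs ≟ length y ] else 0)
    checking-run [] ls xs h =
      next refl (fits [] xs h)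
        (decrement-run true true [] xs h last)
      where
      rs = subtract true xs ʳ++ []
      room = subtract-fits xs h
      last : config (decrement true (borrowOut true xs)) (scan ls [] ⊣) (work rs [])
        ↝ [ value proj₂ xs ≟ 0 ]
      last with borrowOut true xs | subtraction true xs
      ... | _ | exact e       rewrite e = halt refl (fits rs [] room)
      ... | _ | underflow _ e rewrite e = halt refl (fits rs [] room)
    checking-run (false ∷ y) ls xs h = halt refl (fits [] xs h)
    checking-run (true ∷ y) ls xs h =
      next refl (fits [] xs h)
        (decrement-run false true [] xs h last)
      where
      rs = subtract true xs ʳ++ []
      room = subtract-fits xs h
      last : config (decrement false (borrowOut true xs)) (scan ls (map bit (true ∷ y)) ⊣) (work rs [])
        ↝ (if and y then [ value proj₂ xs ≟ suc (length y) ] else 0)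
      last with borrowOut true xs | subtraction true xs
      ... | _ | exact e rewrite e =
        next refl (fits rs [] room)
          (rework (sym (work-end rs)) (return-run rs [] room
            (reinput (sym (moveBounded-right ls (bit true) (map bit y) ⊣))
              (rework (sym (cong (work []) (double-reverse (subtract true xs))))
              (checking-run y (bit true ∷ ls) (subtract true xs)
                (subst (λ l → 2 + l ≤ s) (sym (length-subtract true xs)) h))))))
      ... | _ | underflow _ e rewrite e =
        recount {c = config (decrement false true) (scan ls (map bit (true ∷ y)) ⊣) (work rs [])}
          (zero-either (and y)) (halt refl (fits rs [] room))
        where
        zero-either : ∀ b → 0 ≡ (if b then 0 else 0)
        zero-either true  = refl
        zero-either false = refl

    module _ {M : ℕ} (room : ∀ w → 2 ^ w ≤ 1 + 2 * M → 2 + w ≤ s) where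

      -- Here m elements have been inserted.  Neither counter exceeds m, and the number w of cells satisfies
      -- 2 ^ w ≤ 1 + 2 m, where the summand 1 allows for no cells and no elements at the beginning.
      building-run : ∀ m y ls xs → value proj₁ xs ≤ m → value proj₂ xs ≤ m →
        2 ^ length xs ≤ 1 + 2 * m → m + length y ≤ M →
        config (home building) (scan ls (map bit y) ⊣) (work [] xs)
          ↝ extendByZero (paths κ (value proj₁ xs) (value proj₂ xs)) y
      building-run m y ls xs hA hB hw hm = go y hm
        where
        fit : ∀ {m w} → m ≤ M → 2 ^ w ≤ 1 + 2 * m → 2 + w ≤ s
        fit h p = room _ (ℕ.≤-trans p (s≤s (ℕ.*-monoʳ-≤ 2 h)))
        here-fits : ∀ y → m + length y ≤ M → 2 + length xs ≤ s
        here-fits y h = fit (ℕ.≤-trans (ℕ.m≤m+n m (length y)) h) hw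
        A = value proj₁ xs
        B = value proj₂ xs
        -- The state of affairs after one more element, given the amounts added to A and B.
        after : ∀ ca cb y → m + suc (length y) ≤ M → ⟦ ca ⟧ + A ≤ suc m → ⟦ cb ⟧ + B ≤ suc m →
          2 + length (add ca cb xs) ≤ s ×
          config (home building) (moveBounded right (scan ls (bit true ∷ map bit y) ⊣)) (work [] (add ca cb xs))
            ↝ extendByZero (paths κ (⟦ ca ⟧ + A) (⟦ cb ⟧ + B)) y
        after ca cb y h pA pB =
            fit (ℕ.≤-trans (ℕ.m≤m+n (suc m) (length y)) h′) width
          , subst₂ (λ i n → config (home building) i _ ↝ n)
              (sym (moveBounded-right ls (bit true) (map bit y) ⊣))
              (cong₂ (λ a b → extendByZero (paths κ a b) y) (value-addA ca cb xs) (value-addB ca cb xs))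
              (building-run (suc m) y (bit true ∷ ls) (add ca cb xs)
                (subst (_≤ suc m) (sym (value-addA ca cb xs)) pA)
                (subst (_≤ suc m) (sym (value-addB ca cb xs)) pB)
                width h′)
          where
          h′ : suc m + length y ≤ M
          h′ = subst (_≤ M) (ℕ.+-suc m (length y)) h
          grow : ∀ {v} → v ≤ suc m → 2 * v ≤ 1 + 2 * suc m
          grow p = ℕ.m≤n⇒m≤1+n (ℕ.*-monoʳ-≤ 2 p)
          width : 2 ^ length (add ca cb xs) ≤ 1 + 2 * suc m
          width with length-add ca cb xs
          ... | inj₁ e        = subst (λ l → 2 ^ l ≤ 1 + 2 * suc m) (sym e)
                                  (ℕ.≤-trans hw (s≤s (ℕ.*-monoʳ-≤ 2 (ℕ.n≤1+n m))))
          ... | inj₂ (inj₁ p) = ℕ.≤-trans p (grow pA)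
          ... | inj₂ (inj₂ p) = ℕ.≤-trans p (grow pB)
        bit+≤ : ∀ b {v} → v ≤ m → ⟦ b ⟧ + v ≤ suc m
        bit+≤ false h = ℕ.m≤n⇒m≤1+n h
        bit+≤ true  h = s≤s h
        go : ∀ y → m + length y ≤ M → config (home building) (scan ls (map bit y) ⊣) (work [] xs)
          ↝ extendByZero (paths κ A B) y
        go [] h = halt refl (fits [] xs (here-fits [] h))
        go (false ∷ y) h =
          next refl (fits [] xs (here-fits (false ∷ y) h))
            (reinput
              (sym (moveBounded-right ls (bit false) (map bit y) ⊣))
              (checking-run y (bit false ∷ ls) xs (here-fits (false ∷ y) h)))
        go (true ∷ y) h =
          recount {c = config (home building) (scan ls (bit true ∷ map bit y) ⊣) (work [] xs)}
            (sym (extendByZero-linear (paths κ (suc A) (suc B)) (paths κ (⟦ κ ⟧ + A) B) A y))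
            (fork refl (fits [] xs (here-fits (true ∷ y) h))
              (increment-run true true [] xs (proj₁ new) (proj₂ new))
              (guess-run false κ false [] xs (proj₁ old) (proj₂ old)))
          where
          new = after true true y h (s≤s hA) (s≤s hB)
          old = after κ false y h (bit+≤ κ hA) (bit+≤ false hB)

  -- With l the length of the input, the counters have at most 1 + log₂ (1 + l) cells, and there is a blank
  -- on either side.
  workspace : List Bool → ℕ
  workspace x = 3 + ⌊log₂ suc (length x) ⌋

  counts : ∀ x → Counts (workspace x) (initial x) (extendByZero (paths κ 0 0) x)
  counts x = next refl (s≤s z≤n)
    (reinput (sym (enter x))
      (building-run {M = length x} room 0 x [ ⊢ ] [] z≤n z≤n ℕ.≤-refl ℕ.≤-refl))
    where
    enter : ∀ x → moveBounded right (inputTape x) ≡ scan [ ⊢ ] (map bit x) ⊣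
    enter []      = refl
    enter (_ ∷ _) = refl
    room : ∀ w → 2 ^ w ≤ 1 + 2 * length x → 2 + w ≤ workspace x
    room w h = s≤s (s≤s (subst₂ _≤_ (⌊log₂[2^n]⌋≡n w) (⌊log₂[2*b]⌋≡1+⌊log₂b⌋ (suc (length x)))
      (⌊log₂⌋-mono-≤ (ℕ.≤-trans h (ℕ.≤-trans (ℕ.n≤1+n _) (ℕ.≤-reflexive (sym (ℕ.*-suc 2 (length x)))))))))

  workspace-log : ∀ x → 2 ≤ length x → workspace x ≤ 5 * ⌊log₂ length x ⌋
  workspace-log x h = bound (length x) h
    where
    bound : ∀ l → 2 ≤ l → 3 + ⌊log₂ suc l ⌋ ≤ 5 * ⌊log₂ l ⌋
    bound l@(suc l-1) h = ℕ.≤-trans (ℕ.+-monoʳ-≤ 3 upper) (absorb ⌊log₂ l ⌋ (⌊log₂⌋-mono-≤ h))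
      where
      upper : ⌊log₂ suc l ⌋ ≤ 1 + ⌊log₂ l ⌋
      upper = ℕ.≤-trans (⌊log₂⌋-mono-≤ {suc l} {2 * l} (ℕ.+-mono-≤ (s≤s {n = l-1} z≤n) (ℕ.m≤m+n l 0)))
        (ℕ.≤-reflexive (⌊log₂[2*b]⌋≡1+⌊log₂b⌋ l))
      absorb : ∀ r → 1 ≤ r → 3 + (1 + r) ≤ 5 * r
      absorb r h = ℕ.≤-trans (ℕ.+-monoˡ-≤ r (ℕ.*-monoʳ-≤ 4 h)) (ℕ.≤-reflexive (ℕ.+-comm (4 * r) r))

  -- For shorter inputs log₂ vanishes and bounds nothing, hence the condition that the length is at
  -- least 2.
  paths∈#L : ∀ g → (∀ n k → paths κ 0 0 n k ≡ g n k) → extendByZero g ∈#L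
  paths∈#L g h = machine κ
    , (5 , 2 , λ x l c r → ℕ.≤-trans (counts⇒space (counts x) r) (workspace-log x l))
    , (λ x → counts⇒halts (counts x))
    , (λ x → subst (λ n → AcceptingPath (initial x) ↔ Fin n) (extendByZero-cong h x)
        (counts⇒paths (counts x)))

corollary3p11 : extendByZero stirling₁ ∈#L × extendByZero stirling₂ ∈#L
corollary3p11 = Execution.paths∈#L true  stirling₁ paths≡stirling₁
              , Execution.paths∈#L false stirling₂ paths≡stirling₂
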